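{- Let $n \geq 4$ be an integer and let $\mathcal{C}_n$ be the Crown Subgraph with parameter $n$ described in the context. Let $G$ be a directed graph such that: (i) the vertex set of $G$ contains $\{1,\dots,5n-10\}$ together with at least one further vertex; (ii) the directed edges of $G$ with both endpoints in $\{1,\dots,5n-10\}$ are exactly the edges of $\mathcal{C}_n$; (iii) the directed edges of $G$ going from a vertex outside $\{1,\dots,5n-10\}$ to a vertex of $\{1,\dots,5n-10\}$ are exactly $n$ edges, called incoming edges and labelled $1,\dots,n$, where the incoming edge labelled $i$ has head $2i-1$ (for $i=1,\dots,n$); (iv) the directed edges of $G$ going from a vertex of $\{1,\dots,5n-10\}$ to a vertex outside it are exactly $n$ edges, called outgoing edges and labelled $1,\dots,n$, whose tails are: vertex $5n-10$ for label $1$; vertex $1$ for label $2$; vertex $2n-1$ for label $n-1$; vertex $2n$ for label $n$; vertex $5n-9-3i$ for label $i+2$, for each $i=1,\dots,\lfloor \frac{n-4}{2}\rfloor$; and vertex $2n-1+3i$ for label $n-1-i$, for each $i=1,\dots,\lceil \frac{n-4}{2}\rceil$. Then every (directed) Hamiltonian cycle of $G$ traverses exactly one incoming edge and exactly one outgoing edge, and these two edges have the same label. Furthermore, for each label $i$, there is only one path that a Hamiltonian cycle of $G$ using the incoming edge labelled $i$ can take through $\mathcal{C}_n$ between that incoming edge and the outgoing edge labelled $i$; i.e., any two Hamiltonian cycles of $G$ using the incoming edge labelled $i$ traverse the same directed path in $\mathcal{C}_n$.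
   Context: All graphs are directed; a Hamiltonian cycle is a directed cycle visiting every vertex exactly once. For an integer $n\ge 4$, the Crown Subgraph $\mathcal{C}_n$ is the directed graph on vertex set $\{1,2,\dots,5n-10\}$ with the following directed edges: $(i,i+1)$ and $(i+1,i)$ for all $i=1,\dots,5n-11$; $(1,5n-10)$ and $(5n-10,1)$; $(2n,2n-2)$ and $(5n-10,2)$; $(2n+3i,\,2n-2-2i)$ for all $i=1,\dots,\lceil \frac{n-4}{2}\rceil$; and $(5n-10-3i,\,2i+2)$ for all $i=1,\dots,\lfloor \frac{n-4}{2}\rfloor$. -}

module Defs where

open import Data.Nat using (ℕ; zero; suc; _+_; _*_; _∸_; _≤_; _<_; ⌊_/2⌋; ⌈_/2⌉)
open import Data.List using (List; []; _∷_; _++_; [_])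
open import Data.List.Membership.Propositional using (_∈_)
open import Data.List.Relation.Unary.Unique.Propositional using (Unique)
open import Data.Product using (_×_; Σ; ∃)
open import Function.Bundles using (_⇔_)

K : ℕ → ℕ
K n = 5 * n ∸ 10

data CrownEdge (n : ℕ) : ℕ → ℕ → Set where
  fwd   : ∀ i → 1 ≤ i → i ≤ 5 * n ∸ 11 → CrownEdge n i (suc i)
  bwd   : ∀ i → 1 ≤ i → i ≤ 5 * n ∸ 11 → CrownEdge n (suc i) i
  wrap₁ : CrownEdge n 1 (K n)
  wrap₂ : CrownEdge n (K n) 1
  ex₁   : CrownEdge n (2 * n) (2 * n ∸ 2)
  ex₂   : CrownEdge n (K n) 2
  chA   : ∀ i → 1 ≤ i → i ≤ ⌈ (n ∸ 4) /2⌉ →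
          CrownEdge n (2 * n + 3 * i) (2 * n ∸ 2 ∸ 2 * i)
  chB   : ∀ i → 1 ≤ i → i ≤ ⌊ (n ∸ 4) /2⌋ →
          CrownEdge n (K n ∸ 3 * i) (2 * i + 2)

data OutTail (n : ℕ) : ℕ → ℕ → Set where
  o₁ : OutTail n 1 (K n)
  o₂ : OutTail n 2 1
  o₃ : OutTail n (n ∸ 1) (2 * n ∸ 1)
  o₄ : OutTail n n (2 * n)
  o₅ : ∀ i → 1 ≤ i → i ≤ ⌊ (n ∸ 4) /2⌋ → OutTail n (i + 2) (5 * n ∸ 9 ∸ 3 * i)
  o₆ : ∀ i → 1 ≤ i → i ≤ ⌈ (n ∸ 4) /2⌉ → OutTail n (n ∸ 1 ∸ i) (2 * n ∸ 1 + 3 * i)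

InCrown : ℕ → ℕ → Set
InCrown n v = 1 ≤ v × v ≤ K n

-- v is a vertex of G (vertex set {1..N}) outside the crown
Outside : ℕ → ℕ → ℕ → Set
Outside N n v = K n < v × v ≤ N

data Consec : List ℕ → ℕ → ℕ → Set where
  here  : ∀ {u v xs} → Consec (u ∷ v ∷ xs) u v
  there : ∀ {x xs u v} → Consec xs u v → Consec (x ∷ xs) u v

CycEdge : List ℕ → ℕ → ℕ → Set
CycEdge []       u v = Consec [] u v
CycEdge (x ∷ xs) u v = Consec (x ∷ xs ++ [ x ]) u v

HamCycle : ℕ → (ℕ → ℕ → Set) → List ℕ → Set
HamCycle N E vs =
  Unique vs × (∀ v → v ∈ vs ⇔ (1 ≤ v × v ≤ N)) × (∀ u v → CycEdge vs u v → E u v)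

{-# OPTIONS --safe #-}
module Submission where

-- Write L = 2n − 1 and k = 5n − 10.  The vertices above L are entered only from their neighbours
-- (k also from 1), and inside the crown the vertices up to L are left only to their neighbours (1
-- also to k).  As a Hamiltonian cycle contains no 2-cycle, it cuts L + 1, …, k at some s into an
-- ascending and a descending run, and 1, …, L at some r into a descending and an ascending one.
-- The outer runs end at s and s + 1 with a chord or an exit, and two consecutive vertices never
-- both carry chords nor both exits, so at most one chord is used.  One of r, r + 1 is even and can
-- start a run only as the head of that chord.  Of the two ways to match the chord with r or r + 1
-- one closes a cycle inside the crown, and the other one determines the label and the path.

open import Defs
open import Data.Empty using (⊥; ⊥-elim)
open import Data.List using ([]; _∷_; _++_; [_])
open import Data.List.Membership.Propositional using (_∈_)
open import Data.List.Membership.Propositional.Properties using (∈-++⁻; ∈-++⁺ˡ; ∈-++⁺ʳ)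
open import Data.List.Relation.Unary.All as All using ([])
open import Data.List.Relation.Unary.AllPairs using ([]; _∷_)
open import Data.List.Relation.Unary.Any using (here; there)
open import Data.List.Relation.Unary.Unique.Propositional using (Unique)
import Data.List.Relation.Unary.Unique.Propositional.Properties as Unique
open import Data.Nat using (ℕ; zero; suc; _+_; _*_; _∸_; _≤_; _<_; s≤s; z≤n; ⌊_/2⌋; ⌈_/2⌉)
open import Data.Nat.Properties
open import Data.Nat.Tactic.RingSolver using (solve)
open import Data.Product using (_×_; Σ; Σ-syntax; _,_; proj₁; proj₂)
open import Data.Sum using (_⊎_; inj₁; inj₂)
open import Function.Base using (case_of_)
open import Function.Bundles using (_⇔_; Equivalence; mk⇔)
open import Relation.Nullary.Decidable using (yes; no)
open import Relation.Binary.PropositionalEquality using (_≡_; refl; sym; trans; cong; subst; subst₂)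

-- The labels match because of how the tails are placed around the chords. Chord A i starts at L + 1
-- + 3i, and the exit labelled n - 1 - i sits just below it at L + 3i; chord B i starts at k - 3i,
-- and the exit labelled i + 2 sits just above it at k + 1 - 3i (vertex 1 if i = 0). So an A-chord
-- has to start at s + 1 and a B-chord at s. A chord from s + 1 to r would close r, ..., 1, k, ...,
-- s + 1, and one from s to r + 1 would close r + 1, ..., s. Hence an A-chord ends at r + 1 = L - 1
-- - 2i and leaves r = 2(n - 1 - i) - 1 to be entered from outside, while a B-chord ends at r = 2i +
-- 2 and leaves r + 1 = 2(i + 2) - 1: in both cases this head belongs to the label of the exit. The
-- obstacle is the boundary: at s = k, s = L, r = 0 or r = L a run is empty, and the edges k → 1, L
-- + 1 → L, 1 → 2 and L → L - 1 need separate arguments. The order of the vertices on the path is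
-- never listed; it is enough that the known edges give every crown vertex but one a successor and
-- every one but one a predecessor.

-- Certificates for linear arithmetic: l ≤ r is a combination of hypotheses whose right-hand
-- side is smaller than its left-hand side by suc c.
contra : ∀ {l r} c → l ≤ r → l ≡ suc (r + c) → ⊥
contra {r = r} c p refl = n≮n _ (≤-trans (s≤s (m≤m+n r c)) p)

infixr 5 _⊹_
infix  6 _⊠_

_⊹_ : ∀ {w x y z} → w ≤ x → y ≤ z → w + y ≤ x + z
_⊹_ = +-mono-≤

_⊠_ : ∀ {x y} k → x ≤ y → k * x ≤ k * y
k ⊠ p = *-monoʳ-≤ k p

≤≡ : ∀ {x y : ℕ} → x ≡ y → x ≤ y
≤≡ = ≤-reflexive

≥≡ : ∀ {x y : ℕ} → x ≡ y → y ≤ x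
≥≡ e = ≤-reflexive (sym e)

compare : ∀ x y → x < y ⊎ x ≡ y ⊎ y < x
compare x y with ≤-<-connex x y
... | inj₂ y<x = inj₂ (inj₂ y<x)
... | inj₁ x≤y with m≤n⇒m<n∨m≡n x≤y
...   | inj₁ x<y = inj₁ x<y
...   | inj₂ x≡y = inj₂ (inj₁ x≡y)

-- Chords and exits of one type recur with period 3, so residues modulo 3 keep them apart. Comparing
-- j with i turns this into linear arithmetic.
apart₁ : ∀ x i j → x + 3 * j ≡ suc (x + 3 * i) → ⊥
apart₁ x i j e with ≤-<-connex j i
... | inj₁ j≤i = contra 0 (≥≡ e ⊹ 3 ⊠ j≤i) (solve (i ∷ j ∷ x ∷ []))
... | inj₂ i<j = contra 1 (≤≡ e ⊹ 3 ⊠ i<j) (solve (i ∷ j ∷ x ∷ []))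

apart₂ : ∀ x i j → x + 3 * j ≡ suc (suc (x + 3 * i)) → ⊥
apart₂ x i j e with ≤-<-connex j i
... | inj₁ j≤i = contra 1 (≥≡ e ⊹ 3 ⊠ j≤i) (solve (i ∷ j ∷ x ∷ []))
... | inj₂ i<j = contra 0 (≤≡ e ⊹ 3 ⊠ i<j) (solve (i ∷ j ∷ x ∷ []))

cancel₃ : ∀ x i j → x + 3 * i ≡ x + 3 * j → i ≡ j
cancel₃ x i j e = *-cancelˡ-≡ i j 3 (+-cancelˡ-≡ x (3 * i) (3 * j) e)

-- No `U` is directly followed by a `D`, so after the first `U` only `U` can occur. It is applied
-- once to the directions in which inner vertices are left and once to those in which outer vertices
-- are entered; in both uses the forbidden pair is a 2-cycle.
threshold : ∀ {U D : ℕ → Set} lo hi → lo ≤ hi →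
  (∀ v → lo ≤ v → v < hi → U v ⊎ D v) →
  (∀ v → lo ≤ v → suc v < hi → U v → D (suc v) → ⊥) →
  Σ[ m ∈ ℕ ] lo ≤ m × m ≤ hi × (∀ v → lo ≤ v → v < m → D v) × (∀ v → m ≤ v → v < hi → U v)
threshold lo zero z≤n split clash = 0 , z≤n , z≤n , (λ _ _ ()) , λ _ _ ()
threshold {U} {D} lo (suc hi) lo≤hi split clash with m≤n⇒m<n∨m≡n lo≤hi
... | inj₂ refl =
    lo , ≤-refl , ≤-refl , (λ v p q → ⊥-elim (n≮n _ (≤-pred (≤-trans (s≤s p) q)))) , λ v p
      q → ⊥-elim (n≮n _ (≤-pred (≤-trans (s≤s p) q)))
... | inj₁ (s≤s lo≤hi′)
    with threshold {U} {D} lo hi lo≤hi′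
           (λ v p q → split v p (m≤n⇒m≤1+n q)) (λ v p q → clash v p (m≤n⇒m≤1+n q))
       | split hi lo≤hi′ ≤-refl
...   | m , lo≤m , m≤hi , dn , up | inj₁ u = m , lo≤m , m≤n⇒m≤1+n m≤hi , dn , up′
  where
  up′ : ∀ v → m ≤ v → v < suc hi → U v
  up′ v p (s≤s q) with m≤n⇒m<n∨m≡n q
  ... | inj₁ v<hi = up v p v<hi
  ... | inj₂ refl = u
...   | m , lo≤m , m≤hi , dn , up | inj₂ d with m≤n⇒m<n∨m≡n m≤hi
...     | inj₁ (s≤s m≤w) = ⊥-elim (clash _ (≤-trans lo≤m m≤w) ≤-refl (up _ m≤w ≤-refl) d)
...     | inj₂ refl =
    suc hi , lo≤hi , ≤-refl , dn′ , λ v p q → ⊥-elim (n≮n _ (≤-pred (≤-trans (s≤s p) q)))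
  where
  dn′ : ∀ v → lo ≤ v → v < suc hi → D v
  dn′ v p (s≤s q) with m≤n⇒m<n∨m≡n q
  ... | inj₁ v<m  = dn v p v<m
  ... | inj₂ refl = d

-- Cyclic lists

consec-source : ∀ zs {y u v} → Consec (zs ++ [ y ]) u v → u ∈ zs
consec-source []          (there ())
consec-source (z ∷ [])    here      = here refl
consec-source (z ∷ _ ∷ _) here      = here refl
consec-source (z ∷ zs)    (there c) = there (consec-source zs c)

consec-target : ∀ {x} ys {u v} → Consec (x ∷ ys) u v → v ∈ ys
consec-target (y ∷ ys) here      = here refl
consec-target []       (there ())
consec-target (y ∷ ys) (there c) = there (consec-target ys c)

consec-functional : ∀ zs {y u v w} → Unique zs →
  Consec (zs ++ [ y ]) u v → Consec (zs ++ [ y ]) u w → v ≡ w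
consec-functional []             _          (there ())
consec-functional (z ∷ [])       _          here      here      = refl
consec-functional (z ∷ _ ∷ _)    _          here      here      = refl
consec-functional (z ∷ zs@[])    _          _         (there (there ()))
consec-functional (z ∷ zs@[])    _          (there (there ()))
consec-functional (z ∷ z′ ∷ zs)  (z∉ ∷ _)   here      (there d) =
  ⊥-elim (All.lookup z∉ (consec-source (z′ ∷ zs) d) refl)
consec-functional (z ∷ z′ ∷ zs)  (z∉ ∷ _)   (there c) here      =
  ⊥-elim (All.lookup z∉ (consec-source (z′ ∷ zs) c) refl)
consec-functional (z ∷ z′ ∷ zs)  (_ ∷ uniq) (there c) (there d) =
  consec-functional (z′ ∷ zs) uniq c d

consec-injective : ∀ {x} ys {u v w} → Unique ys →
  Consec (x ∷ ys) u w → Consec (x ∷ ys) v w → u ≡ v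
consec-injective []       _          (there ())
consec-injective (y ∷ ys) _          here      here      = refl
consec-injective (y ∷ ys) (y∉ ∷ _)   here      (there d) =
  ⊥-elim (All.lookup y∉ (consec-target ys d) refl)
consec-injective (y ∷ ys) (y∉ ∷ _)   (there c) here      =
  ⊥-elim (All.lookup y∉ (consec-target ys c) refl)
consec-injective (y ∷ ys) (_ ∷ uniq) (there c) (there d) = consec-injective ys uniq c d

consec-next : ∀ zs {y u} → u ∈ zs → Σ[ v ∈ ℕ ] Consec (zs ++ [ y ]) u v
consec-next (z ∷ [])      (here refl) = _ , here
consec-next (z ∷ z′ ∷ zs) (here refl) = _ , here
consec-next (z ∷ zs)      (there u∈)  = let v , c = consec-next zs u∈ in v , there c

consec-prev : ∀ {x} ys {v} → v ∈ ys → Σ[ u ∈ ℕ ] Consec (x ∷ ys) u v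
consec-prev (y ∷ ys) (here refl) = _ , here
consec-prev (y ∷ ys) (there v∈)  = let u , c = consec-prev ys v∈ in u , there c

consec-sweep : ∀ (P : ℕ → Set) x ys → (∀ {u v} → Consec (x ∷ ys) u v → P u → P v) →
  P x → ∀ {w} → w ∈ ys → P w
consec-sweep P x (y ∷ ys) step px (here refl) = step here px
consec-sweep P x (y ∷ ys) step px (there w∈)  =
  consec-sweep P y ys (λ c → step (there c)) (step here px) w∈

consec-reach : ∀ (P : ℕ → Set) zs {y w} → (∀ {u v} → Consec (zs ++ [ y ]) u v → P u → P v) →
  w ∈ zs → P w → P y
consec-reach P (z ∷ [])      step (here refl) pw = step here pw
consec-reach P (z ∷ z′ ∷ zs) step (here refl) pw =
  consec-reach P (z′ ∷ zs) (λ c → step (there c)) (here refl) (step here pw)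
consec-reach P (z ∷ z′ ∷ zs) step (there w∈)  pw =
  consec-reach P (z′ ∷ zs) (λ c → step (there c)) w∈ pw

cycle-functional : ∀ vs {u v w} → Unique vs → CycEdge vs u v → CycEdge vs u w → v ≡ w
cycle-functional (x ∷ xs) uniq = consec-functional (x ∷ xs) uniq

-- The heads of the edges are the entries of `xs ++ [ x ]`, a rotation of the cycle, so they are
-- again distinct.
cycle-injective : ∀ vs {u v w} → Unique vs → CycEdge vs u w → CycEdge vs v w → u ≡ v
cycle-injective (x ∷ xs) (x∉ ∷ uniq) = consec-injective (xs ++ [ x ])
  (Unique.++⁺ uniq ([] ∷ []) λ { (v∈ , here refl) → All.lookup x∉ v∈ refl })

cycle-source : ∀ vs {u v} → CycEdge vs u v → u ∈ vs
cycle-source (x ∷ xs) = consec-source (x ∷ xs)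

cycle-target : ∀ vs {u v} → CycEdge vs u v → v ∈ vs
cycle-target (x ∷ xs) c with ∈-++⁻ xs (consec-target (xs ++ [ x ]) c)
... | inj₁ v∈          = there v∈
... | inj₂ (here refl) = here refl

cycle-next : ∀ vs {u} → u ∈ vs → Σ[ v ∈ ℕ ] CycEdge vs u v
cycle-next (x ∷ xs) = consec-next (x ∷ xs)

cycle-prev : ∀ vs {v} → v ∈ vs → Σ[ u ∈ ℕ ] CycEdge vs u v
cycle-prev (x ∷ xs) (here refl) = consec-prev (xs ++ [ x ]) (∈-++⁺ʳ xs (here refl))
cycle-prev (x ∷ xs) (there v∈)  = consec-prev (xs ++ [ x ]) (∈-++⁺ˡ v∈)

-- Two legs: `consec-reach` carries `P` from u to the copy of `x` that closes the list, and
-- `consec-sweep` carries it from the initial `x` to every vertex.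
cycle-sweep : ∀ (P : ℕ → Set) vs → (∀ {u v} → CycEdge vs u v → P u → P v) →
  ∀ {u w} → u ∈ vs → P u → w ∈ vs → P w
cycle-sweep P (x ∷ xs) step u∈ pu (here refl) = consec-reach P (x ∷ xs) step u∈ pu
cycle-sweep P (x ∷ xs) step u∈ pu (there w∈)  =
  consec-sweep P x (xs ++ [ x ]) step (consec-reach P (x ∷ xs) step u∈ pu) (∈-++⁺ˡ w∈)

-- The crown

-- L = 2n − 1 and k = 5n − 10, so that 1, …, L are the vertices with incoming edges and the even
-- vertices between them; a and b count the chords chA and chB, and m is the last exit of type chA.
record Dimensions (a b L m k n : ℕ) : Set where
  field
    L≡ : L ≡ 7 + 2 * (a + b)
    m≡ : m ≡ L + 3 * a
    k≡ : k ≡ 3 + m + 3 * b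
    n≡ : n ≡ 4 + (a + b)

-- L, m and k are variables tied by equations, so the ring solver treats them as atoms and each
-- certificate names the equations that it uses.
module Crown (a b L m k n : ℕ) (dimensions : Dimensions a b L m k n) where
  open Dimensions dimensions

  -- Abstract, so that `with` does not normalise the certificates.
  abstract
    7≤L : 7 ≤ L
    7≤L = ≮⇒≥ λ (neg : L < 7) → contra (2 * a + 2 * b) (≥≡ L≡ ⊹ neg) (solve (L ∷ a ∷ b ∷ []))

    L≤m : L ≤ m
    L≤m = ≮⇒≥ λ (neg : m < L) → contra (3 * a) (≥≡ m≡ ⊹ neg) (solve (L ∷ a ∷ m ∷ []))

    3+m≤k : 3 + m ≤ k
    3+m≤k = ≮⇒≥ λ (neg : k < 3 + m) → contra (3 * b) (≥≡ k≡ ⊹ neg) (solve (b ∷ k ∷ m ∷ []))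

    1≤L : 1 ≤ L
    1≤L = ≤-trans (m≤n+m _ 6) 7≤L

    3+L≤k : 3 + L ≤ k
    3+L≤k = ≤-trans (s≤s (s≤s (s≤s L≤m))) 3+m≤k

    L≤k : L ≤ k
    L≤k = ≤-trans (m≤n+m _ 3) 3+L≤k

    1≤k : 1 ≤ k
    1≤k = ≤-trans 1≤L L≤k

  -- Index 0 stands for the chords ex₁ and ex₂.
  data Chord (u v : ℕ) : Set where
    A : ∀ i → i ≤ a → u ≡ suc L + 3 * i → v + 1 + 2 * i ≡ L → Chord u v
    B : ∀ i → i ≤ b → u + 3 * i ≡ k → v ≡ 2 * i + 2 → Chord u v

  -- As in `Chord`, the ends are given by equations and not by indices, so that a case split never
  -- has to unify sums or products.
  data Step (u v : ℕ) : Set where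
    up    : v ≡ suc u → Step u v
    down  : u ≡ suc v → Step u v
    wrap₁ : u ≡ 1 → v ≡ k → Step u v
    wrap₂ : u ≡ k → v ≡ 1 → Step u v
    chord : Chord u v → Step u v

  -- A 0 is the exit o₃ at L; vertex 1 plays the part of k + 1, so second stands for B 0.
  data Exit (l u : ℕ) : Set where
    first  : l ≡ 1 → u ≡ k → Exit l u
    second : l ≡ 2 → u ≡ 1 → Exit l u
    last   : l ≡ n → u ≡ suc L → Exit l u
    A      : ∀ i → i ≤ a → u ≡ L + 3 * i → l + 1 + i ≡ n → Exit l u
    B      : ∀ i → 1 ≤ i → i ≤ b → u + 3 * i ≡ suc k → l ≡ i + 2 → Exit l u

  -- Linear bounds for chords, exits and labels

  abstract
    A-bound : ∀ u i → i ≤ a → u ≡ L + 3 * i → L ≤ u × u ≤ m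
    A-bound u i i≤a e =
      (≮⇒≥ λ (neg : u < L) → contra (3 * i) (≥≡ e ⊹ neg) (solve (L ∷ i ∷ u ∷ []))) ,
        ≮⇒≥ λ (neg : m < u) → contra 0 (≥≡ m≡ ⊹ ≤≡ e ⊹ 3 ⊠ i≤a ⊹ neg)
        (solve (L ∷ a ∷ i ∷ m ∷ u ∷ []))

    A-chord-bound : ∀ u i → i ≤ a → u ≡ suc L + 3 * i → u ≤ suc m
    A-chord-bound (suc u) i i≤a e = s≤s (proj₂ (A-bound u i i≤a (suc-injective e)))

    B-bound : ∀ x u i → i ≤ b → u + 3 * i ≡ x + k → x + 3 + m ≤ u × u ≤ x + k
    B-bound x u i i≤b e =
      (≮⇒≥ λ (neg : u < x + 3 + m) → contra 0 (≥≡ k≡ ⊹ ≥≡ e ⊹ 3 ⊠ i≤b ⊹ neg)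
        (solve (b ∷ i ∷ k ∷ m ∷ u ∷ x ∷ []))) ,
        ≮⇒≥ λ (neg : x + k < u) → contra (3 * i) (≤≡ e ⊹ neg) (solve (i ∷ k ∷ u ∷ x ∷ []))

    B-target : ∀ q i → i ≤ b → q ≡ 2 * i + 2 → 2 ≤ q × 5 + q ≤ L
    B-target q i i≤b e =
      (≮⇒≥ λ (neg : q < 2) → contra (2 * i) (≥≡ e ⊹ neg) (solve (i ∷ q ∷ []))) ,
        ≮⇒≥ λ (neg : L < 5 + q) → contra (2 * a) (≥≡ L≡ ⊹ ≤≡ e ⊹ 2 ⊠ i≤b ⊹ neg)
        (solve (L ∷ a ∷ b ∷ i ∷ q ∷ []))

    A-target : ∀ q i → i ≤ a → q + 1 + 2 * i ≡ L → 6 ≤ q × q < L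
    A-target q i i≤a e =
      (≮⇒≥ λ (neg : q < 6) → contra (2 * b) (≥≡ L≡ ⊹ ≥≡ e ⊹ 2 ⊠ i≤a ⊹ neg)
        (solve (L ∷ a ∷ b ∷ i ∷ q ∷ []))) ,
        ≮⇒≥ λ (neg : L < suc q) → contra (2 * i) (≤≡ e ⊹ neg) (solve (L ∷ i ∷ q ∷ []))

    -- `suc (suc q) ≡ 2 * l` means that q + 1 is the head 2l - 1 of the incoming edge l. So the
    -- vertex just above the head of a B-chord has the label of the exit just above its source.
    B-label : ∀ q i l → q ≡ 2 * i + 2 → suc (suc q) ≡ 2 * l → i + 2 ≡ l
    B-label q i l e e′ =
      ≤-antisym (≮⇒≥ λ (neg : l < i + 2) → contra 1 (≤≡ e′ ⊹ ≥≡ e ⊹ 2 ⊠ neg)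
        (solve (i ∷ l ∷ q ∷ [])))
        (≮⇒≥ λ (neg : i + 2 < l) → contra 1 (≥≡ e′ ⊹ ≤≡ e ⊹ 2 ⊠ neg) (solve (i ∷ l ∷ q ∷ [])))

    -- Mirror image of `B-label`: here q - 1 is the head 2l - 1, and it has the label of the exit
    -- just below the source of the A-chord.
    A-label : ∀ q i l → q + 1 + 2 * i ≡ L → q ≡ 2 * l → l + 1 + i ≡ n
    A-label q i l e e′ =
      ≤-antisym (≮⇒≥ λ (neg : n < l + 1 + i) → contra 1
        (≤≡ L≡ ⊹ 2 ⊠ (≥≡ n≡) ⊹ ≥≡ e′ ⊹ ≤≡ e ⊹ 2 ⊠ neg) (solve (L ∷ a ∷ b ∷ i ∷ l ∷ n ∷ q ∷ [])))
        (≮⇒≥ λ (neg : l + 1 + i < n) → contra 1 (≥≡ L≡ ⊹ 2 ⊠ (≤≡ n≡) ⊹ ≤≡ e′ ⊹ ≥≡ e ⊹ 2 ⊠ neg)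
        (solve (L ∷ a ∷ b ∷ i ∷ l ∷ n ∷ q ∷ [])))

    A-label-bound : ∀ l i → i ≤ a → l + 1 + i ≡ n → 3 + b ≤ l × l < n
    A-label-bound l i i≤a e =
      (≮⇒≥ λ (neg : l < 3 + b) → contra 0 (≥≡ n≡ ⊹ ≥≡ e ⊹ i≤a ⊹ neg)
        (solve (a ∷ b ∷ i ∷ l ∷ n ∷ []))) ,
        ≮⇒≥ λ (neg : n < suc l) → contra i (≤≡ e ⊹ neg) (solve (i ∷ l ∷ n ∷ []))

    last-label : ∀ l → suc L ≡ 2 * l → l ≡ n
    last-label l e =
      ≤-antisym (≮⇒≥ λ (neg : n < l) → contra 1 (≤≡ L≡ ⊹ 2 ⊠ (≥≡ n≡) ⊹ ≥≡ e ⊹ 2 ⊠ neg)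
        (solve (L ∷ a ∷ b ∷ l ∷ n ∷ [])))
        (≮⇒≥ λ (neg : l < n) → contra 1 (≥≡ L≡ ⊹ 2 ⊠ (≤≡ n≡) ⊹ ≤≡ e ⊹ 2 ⊠ neg)
        (solve (L ∷ a ∷ b ∷ l ∷ n ∷ [])))

    head≤L : ∀ v l → suc v ≡ 2 * l → l ≤ n → v ≤ L
    head≤L v l e l≤n =
      ≮⇒≥ λ (neg : L < v) → contra 0 (≥≡ L≡ ⊹ 2 ⊠ (≤≡ n≡) ⊹ 2 ⊠ l≤n ⊹ ≤≡ e ⊹ neg)
        (solve (L ∷ a ∷ b ∷ l ∷ n ∷ v ∷ []))

    even≢L : ∀ l → L ≡ 2 * l → ⊥
    even≢L l e =
      even≢odd l (3 + (a + b)) (≤-antisym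
        (≮⇒≥ λ (neg : suc (2 * (3 + (a + b))) < 2 * l) → contra 0 (≤≡ L≡ ⊹ ≥≡ e ⊹ neg)
        (solve (L ∷ a ∷ b ∷ l ∷ [])))
        (≮⇒≥ λ (neg : 2 * l < suc (2 * (3 + (a + b)))) → contra 0 (≥≡ L≡ ⊹ ≤≡ e ⊹ neg)
        (solve (L ∷ a ∷ b ∷ l ∷ []))))

  -- Positions of chords and exits relative to each other

  chord-source : ∀ {u v} → Chord u v → L < u × u ≤ k
  chord-source {suc u} (A i i≤a e _) with A-bound u i i≤a (suc-injective e)
  ... | L≤u , u≤m = s≤s L≤u , ≤-trans (m≤n+m _ 2) (≤-trans (s≤s (s≤s (s≤s u≤m))) 3+m≤k)
  chord-source {u} (B i i≤b e _) with B-bound 0 u i i≤b e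
  ... | m<u , u≤k = ≤-trans (m≤n+m _ 2) (≤-trans (s≤s (s≤s (s≤s L≤m))) m<u) , u≤k

  chord-target : ∀ {u v} → Chord u v → 2 ≤ v × v < L
  chord-target {v = v} (A i i≤a _ e) with A-target v i i≤a e
  ... | 6≤v , v<L = ≤-trans (m≤n+m _ 4) 6≤v , v<L
  chord-target {v = v} (B i i≤b _ e) with B-target v i i≤b e
  ... | 2≤v , v<L = 2≤v , ≤-trans (m≤n+m _ 4) v<L

  exit-tail : ∀ {l u} → Exit l u → u ≡ 1 ⊎ L ≤ u
  exit-tail (second _ e)            = inj₁ e
  exit-tail {u = u} (first _ e)     = inj₂ (≤-trans (m≤n+m _ 3) (≤-trans 3+L≤k (≥≡ e)))
  exit-tail {u = u} (last _ e)      = inj₂ (<⇒≤ (≥≡ e))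
  exit-tail {u = u} (A i i≤a e _)   = inj₂ (proj₁ (A-bound u i i≤a e))
  exit-tail {u = u} (B i _ i≤b e _) =
    inj₂ (≤-trans (m≤n+m _ 4) (≤-trans (s≤s (s≤s (s≤s (s≤s L≤m)))) (proj₁ (B-bound 1 u i i≤b e))))

  exit-label₁ : ∀ {l} → Exit l k → l ≡ 1
  exit-label₁ (first e _)              = e
  exit-label₁ (second _ e)             =
    ⊥-elim (n≮0 (≤-trans (m≤n+m _ 8)
      (≤-pred (≤-trans (s≤s (s≤s (s≤s 7≤L))) (≤-trans 3+L≤k (≤≡ e))))))
  exit-label₁ (last _ e)               = ⊥-elim (n≮n _ (<⇒≤ (≤-pred (≤-trans 3+L≤k (≤≡ e)))))
  exit-label₁ (A i i≤a e _)            =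
    ⊥-elim (n≮n _ (≤-trans (m≤n+m _ 2)
      (≤-trans (s≤s (s≤s (s≤s (proj₂ (A-bound k i i≤a e))))) 3+m≤k)))
  exit-label₁ (B (suc i) _ i≤b e _)    =
    ⊥-elim (apart₁ k 0 (suc i) (trans e (cong suc (sym (+-identityʳ k)))))

  exit-label₂ : ∀ {l} → Exit l 1 → l ≡ 2
  exit-label₂ (first _ e)     =
    ⊥-elim (n≮0 (≤-trans (m≤n+m _ 8)
      (≤-pred (≤-trans (s≤s (s≤s (s≤s 7≤L))) (≤-trans 3+L≤k (≥≡ e))))))
  exit-label₂ (second e _)    = e
  exit-label₂ (last _ e)      =
    ⊥-elim (n≮0 (≤-trans (m≤n+m _ 6) (≤-pred (≤-trans (s≤s 7≤L) (≥≡ e)))))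
  exit-label₂ (A i i≤a e _)   =
    ⊥-elim (n≮0 (≤-trans (m≤n+m _ 5) (≤-pred (≤-trans 7≤L (proj₁ (A-bound 1 i i≤a e))))))
  exit-label₂ (B i _ i≤b e _) =
    ⊥-elim (n≮0 (≤-trans (m≤n+m _ 2)
      (≤-pred (≤-trans (s≤s (s≤s (s≤s (s≤s z≤n)))) (proj₁ (B-bound 1 1 i i≤b e))))))

  -- The conclusion is written as the label equation of A 0, the form that `chordA` asks for when s
  -- = L.
  exit-label-top : ∀ {l} → Exit l L → l + 1 + 0 ≡ n
  exit-label-top (first _ e)     = ⊥-elim (n≮n _ (≤-trans (m≤n+m _ 2) (≤-trans 3+L≤k (≥≡ e))))
  exit-label-top (second _ e)    = ⊥-elim (n≮0 (≤-trans (m≤n+m _ 5) (≤-pred (≤-trans 7≤L (≤≡ e)))))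
  exit-label-top (last _ e)      = ⊥-elim (n≮n _ (≥≡ e))
  exit-label-top {l} (A i i≤a e l≡) with cancel₃ L 0 i (trans (+-identityʳ L) e)
  ... | refl = l≡
  exit-label-top (B i _ i≤b e _) =
    ⊥-elim (n≮n _ (≤-trans (m≤n+m _ 3)
      (≤-trans (s≤s (s≤s (s≤s (s≤s L≤m)))) (proj₁ (B-bound 1 L i i≤b e)))))

  exit-label-n : ∀ {l} → Exit l (suc L) → l ≡ n
  exit-label-n (first _ e)     = ⊥-elim (n≮n _ (<⇒≤ (≤-pred (≤-trans 3+L≤k (≥≡ e)))))
  exit-label-n (second _ e)    =
    ⊥-elim (n≮0 (≤-trans (m≤n+m _ 6) (≤-pred (≤-trans (s≤s 7≤L) (≤≡ e)))))
  exit-label-n (last e _)      = e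
  exit-label-n (A i i≤a e _)   =
    ⊥-elim (apart₁ L 0 i (trans (sym e) (cong suc (sym (+-identityʳ L)))))
  exit-label-n (B i _ i≤b e _) =
    ⊥-elim (n≮n _ (≤-trans (m≤n+m _ 2)
      (≤-pred (≤-trans (s≤s (s≤s (s≤s (s≤s L≤m)))) (proj₁ (B-bound 1 (suc L) i i≤b e))))))

  -- Within one type the sources are 3 apart, and between the last A-source m + 1 and the first
  -- B-source m + 3 one vertex is left free.
  chords-apart : ∀ {s v w} → Chord s v → Chord (suc s) w → ⊥
  chords-apart (A i _ e _) (A j _ e′ _) = apart₁ (suc L) i j (trans (sym e′) (cong suc e))
  chords-apart {s} (B i _ e _) (B j _ e′ _) = apart₁ s j i (trans e (sym e′))
  chords-apart {suc s} (A i i≤a e _) (B j j≤b e′ _)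
    with A-bound s i i≤a (suc-injective e) | B-bound 0 (suc (suc s)) j j≤b e′
  ... | L≤s , s≤m | m<s , s≤k = n≮n _ (≤-pred (≤-pred (≤-trans m<s (s≤s (s≤s s≤m)))))
  chords-apart {s} (B i i≤b e _) (A j j≤a e′ _)
    with A-bound s j j≤a (suc-injective e′) | B-bound 0 s i i≤b e
  ... | L≤s , s≤m | m<s , s≤k = n≮n _ (≤-trans (m≤n+m _ 2) (≤-trans m<s s≤m))

  -- From L + 1 on the tails are L + 1, then L + 3i up to m, then k + 1 - 3i from m + 4 to k - 2,
  -- and finally k; neighbours in this list differ by at least 2. The bound `L < s` excludes the
  -- consecutive tails L and L + 1.
  exits-apart : ∀ {s l l′} → L < s → s < k → Exit l s → Exit l′ (suc s) → ⊥
  exits-apart {s} L<s s<k (first _ e) _  = n≮n _ (≤-trans (s≤s (≥≡ e)) s<k)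
  exits-apart {s} L<s s<k (second _ e) _ =
    n≮0 (≤-trans (m≤n+m _ 6) (≤-pred (≤-trans (s≤s 7≤L) (≤-trans L<s (≤≡ e)))))
  exits-apart {s} L<s s<k _ (second _ e) =
    n≮0 (≤-trans (m≤n+m _ 7) (≤-pred (≤-trans (s≤s (s≤s 7≤L)) (≤-trans (s≤s L<s) (≤≡ e)))))
  exits-apart {s} L<s s<k _ (last _ e)   = n≮n _ (≤-pred (≤-trans (s≤s L<s) (≤≡ e)))
  exits-apart {s} L<s s<k (last _ e) (first _ e′) =
    n≮n _ (≤-pred (≤-pred (≤-trans 3+L≤k (≤-trans (≥≡ e′) (s≤s (≤≡ e))))))
  exits-apart L<s s<k (last _ e) (A j _ e′ _) =
    apart₂ L 0 j (trans (sym e′) (cong suc (trans e (cong suc (sym (+-identityʳ L))))))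
  exits-apart {s} L<s s<k (last _ e) (B j _ j≤b e′ _)      =
    n≮n _ (<⇒≤ (≤-pred (≤-pred
      (≤-trans (s≤s (s≤s (s≤s (s≤s L≤m))))
      (≤-trans (proj₁ (B-bound 1 (suc s) j j≤b e′)) (s≤s (≤≡ e)))))))
  exits-apart {s} L<s s<k (A i i≤a e _) (first _ e′)       =
    n≮n _ (<⇒≤ (≤-trans (s≤s (s≤s (≥≡ e′)))
      (≤-trans (s≤s (s≤s (s≤s (proj₂ (A-bound s i i≤a e))))) 3+m≤k)))
  exits-apart L<s s<k (A i _ e _) (A j _ e′ _)             =
    apart₁ L i j (trans (sym e′) (cong suc e))
  exits-apart {s} L<s s<k (A i i≤a e _) (B j _ j≤b e′ _)   =
    (n≮n _ (≤-trans (m≤n+m _ 2)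
        (≤-pred (≤-trans (proj₁ (B-bound 1 (suc s) j j≤b e′)) (s≤s (proj₂ (A-bound s i i≤a e)))))))
  exits-apart {s} L<s s<k (B i _ i≤b e _) (first _ e′) =
    apart₂ s 0 i (trans e (cong suc (trans (sym e′) (cong suc (sym (+-identityʳ s))))))
  exits-apart {s} L<s s<k (B i _ i≤b e _) (A j j≤a e′ _)   =
    (n≮n _ (≤-trans (m≤n+m _ 4)
        (≤-trans (s≤s (proj₁ (B-bound 1 s i i≤b e))) (proj₂ (A-bound (suc s) j j≤a e′)))))
  exits-apart {s} L<s s<k (B i _ _ e _) (B j _ _ e′ _)     = apart₁ s j i (trans e (sym e′))

  -- This lemma and the next three treat a chord next to an exit. Exits sit directly below A-sources
  -- and directly above B-sources, so two of the four arrangements are impossible, and in the other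
  -- two the index of the chord fixes the label.
  chordA-below-exit : ∀ {s l} i → i ≤ a → s ≡ suc L + 3 * i → L < s → s < k → Exit l (suc s) → ⊥
  chordA-below-exit {suc s} i i≤a u≡ L<s s<k (first _ e)     =
    n≮n _ (≤-trans (s≤s (≥≡ e))
      (≤-trans (s≤s (s≤s (s≤s (proj₂ (A-bound s i i≤a (suc-injective u≡)))))) 3+m≤k))
  chordA-below-exit {suc s} i i≤a u≡ L<s s<k (second _ e)    =
    n≮0 (≤-pred (≤-trans (s≤s (s≤s z≤n)) (≤≡ e)))
  chordA-below-exit {suc s} i i≤a u≡ L<s s<k (last _ e)      =
    n≮n _ (≤-pred (≤-trans (s≤s L<s) (≤≡ e)))
  chordA-below-exit {suc s} i i≤a u≡ L<s s<k (A j _ e _)     =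
    apart₂ L i j (trans (sym e) (cong suc u≡))
  chordA-below-exit {suc s} i i≤a u≡ L<s s<k (B j _ j≤b e _) =
    (n≮n _ (<⇒≤ (≤-pred (≤-pred
        (≤-trans (proj₁ (B-bound 1 (suc (suc s)) j j≤b e))
        (s≤s (s≤s (proj₂ (A-bound s i i≤a (suc-injective u≡))))))))))

  chordB-below-exit : ∀ {s l} i → i ≤ b → s + 3 * i ≡ k → L < s → s < k → Exit l (suc s) → l ≡ i + 2
  chordB-below-exit {s} i i≤b u≡ L<s s<k (first _ e)  =
    ⊥-elim (apart₁ s 0 i (trans u≡ (trans (sym e) (cong suc (sym (+-identityʳ s))))))
  chordB-below-exit {s} i i≤b u≡ L<s s<k (second _ e) =
    ⊥-elim (n≮0 (≤-trans (m≤n+m _ 7) (≤-pred (≤-trans (s≤s (s≤s 7≤L)) (≤-trans (s≤s L<s) (≤≡ e))))))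
  chordB-below-exit {s} i i≤b u≡ L<s s<k (last _ e)   =
    ⊥-elim (n≮n _ (≤-pred (≤-trans (s≤s L<s) (≤≡ e))))
  chordB-below-exit {s} i i≤b u≡ L<s s<k (A j j≤a e _) =
    ⊥-elim (n≮n _ (≤-trans (m≤n+m _ 3)
        (≤-trans (s≤s (proj₁ (B-bound 0 s i i≤b u≡))) (proj₂ (A-bound (suc s) j j≤a e)))))
  chordB-below-exit {s} i i≤b u≡ L<s s<k (B j _ _ e l≡)
    with cancel₃ s i j (trans u≡ (sym (suc-injective e)))
  ... | refl = l≡

  exit-below-chordA : ∀ {s l} i → i ≤ a → suc s ≡ suc L + 3 * i → L < s → s < k → Exit l
      s → l + 1 + i ≡ n
  exit-below-chordA {s} i i≤a u≡ L<s s<k (first _ e)  = ⊥-elim (n≮n _ (≤-trans (s≤s (≥≡ e)) s<k))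
  exit-below-chordA {s} i i≤a u≡ L<s s<k (second _ e) =
    ⊥-elim (n≮0 (≤-trans (m≤n+m _ 6) (≤-pred (≤-trans (s≤s 7≤L) (≤-trans L<s (≤≡ e))))))
  exit-below-chordA {s} i i≤a u≡ L<s s<k (last _ e)   =
    ⊥-elim (apart₁ (suc L) 0 i (trans (sym u≡) (cong suc (trans e (sym (+-identityʳ (suc L)))))))
  exit-below-chordA {s} i i≤a u≡ L<s s<k (A j _ e l≡)
    with cancel₃ L i j (trans (sym (suc-injective u≡)) e)
  ... | refl = l≡
  exit-below-chordA {s} i i≤a u≡ L<s s<k (B j _ j≤b e _) =
    ⊥-elim (n≮n _ (≤-trans (m≤n+m _ 3)
        (≤-trans (proj₁ (B-bound 1 s j j≤b e)) (proj₂ (A-bound s i i≤a (suc-injective u≡))))))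

  exit-below-chordB : ∀ {s l} i → i ≤ b → suc s + 3 * i ≡ k → L < s → s < k → Exit l s → ⊥
  exit-below-chordB {s} i i≤b u≡ L<s s<k (first _ e)   = n≮n _ (≤-trans (s≤s (≥≡ e)) s<k)
  exit-below-chordB {s} i i≤b u≡ L<s s<k (second _ e)  =
    n≮0 (≤-trans (m≤n+m _ 6) (≤-pred (≤-trans (s≤s 7≤L) (≤-trans L<s (≤≡ e)))))
  exit-below-chordB {s} i i≤b u≡ L<s s<k (last _ e)    =
    n≮n _ (≤-pred (≤-pred (≤-trans (s≤s (s≤s (s≤s L≤m)))
      (≤-trans (proj₁ (B-bound 0 (suc s) i i≤b u≡)) (s≤s (≤≡ e))))))
  exit-below-chordB {s} i i≤b u≡ L<s s<k (A j j≤a e _) =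
    (n≮n _ (<⇒≤ (≤-pred (≤-trans (proj₁ (B-bound 0 (suc s) i i≤b u≡))
        (s≤s (proj₂ (A-bound s j j≤a e)))))))
  exit-below-chordB {s} i i≤b u≡ L<s s<k (B j _ _ e _) = apart₂ s i j (trans e (cong suc (sym u≡)))

  -- Translation of the given edges and tails into chords and exits

  abstract
    2n≡1+L : 2 * n ≡ suc L
    2n≡1+L =
      ≤-antisym (≮⇒≥ λ (neg : suc L < 2 * n) → contra 0 (≥≡ L≡ ⊹ 2 ⊠ (≤≡ n≡) ⊹ neg)
        (solve (L ∷ a ∷ b ∷ n ∷ [])))
        (≮⇒≥ λ (neg : 2 * n < suc L) → contra 0 (≤≡ L≡ ⊹ 2 ⊠ (≥≡ n≡) ⊹ neg)
        (solve (L ∷ a ∷ b ∷ n ∷ [])))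

    5n≡10+k : 5 * n ≡ 10 + k
    5n≡10+k =
      ≤-antisym (≮⇒≥ λ (neg : 10 + k < 5 * n) → contra 0 (≥≡ L≡ ⊹ ≥≡ m≡ ⊹ ≥≡ k≡ ⊹ 5 ⊠ (≤≡ n≡) ⊹ neg)
        (solve (L ∷ a ∷ b ∷ k ∷ m ∷ n ∷ [])))
        (≮⇒≥ λ (neg : 5 * n < 10 + k) → contra 0 (≤≡ L≡ ⊹ ≤≡ m≡ ⊹ ≤≡ k≡ ⊹ 5 ⊠ (≥≡ n≡) ⊹ neg)
        (solve (L ∷ a ∷ b ∷ k ∷ m ∷ n ∷ [])))

    K≡k : K n ≡ k
    K≡k = cong (_∸ 10) 5n≡10+k

    A-end : ∀ d i → d + 2 * i + 2 ≡ 2 * n → d + 1 + 2 * i ≡ L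
    A-end d i e =
      ≤-antisym (≮⇒≥ λ (neg : L < d + 1 + 2 * i) → contra 0 (≤≡ 2n≡1+L ⊹ ≤≡ e ⊹ neg)
        (solve (L ∷ d ∷ i ∷ n ∷ [])))
        (≮⇒≥ λ (neg : d + 1 + 2 * i < L) → contra 0 (≥≡ 2n≡1+L ⊹ ≥≡ e ⊹ neg)
        (solve (L ∷ d ∷ i ∷ n ∷ [])))

    A-room : ∀ i → i ≤ a → 2 * i + 2 ≤ 2 * n
    A-room i i≤a =
      ≮⇒≥ λ (neg : 2 * n < 2 * i + 2) → contra (6 + 2 * b) (2 ⊠ (≥≡ n≡) ⊹ 2 ⊠ i≤a ⊹ neg)
        (solve (a ∷ b ∷ i ∷ n ∷ []))

    B-room : ∀ i → i ≤ b → 3 * i ≤ k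
    B-room i i≤b =
      ≮⇒≥ λ (neg : k < 3 * i) → contra (3 + m) (≥≡ k≡ ⊹ 3 ⊠ i≤b ⊹ neg) (solve (b ∷ i ∷ k ∷ m ∷ []))

    label-end : ∀ d i x → d + i ≡ x → x + 1 ≡ n → d + 1 + i ≡ n
    label-end d i x e e′ =
      ≤-antisym (≮⇒≥ λ (neg : n < d + 1 + i) → contra 0 (≤≡ e′ ⊹ ≤≡ e ⊹ neg)
        (solve (d ∷ i ∷ n ∷ x ∷ [])))
        (≮⇒≥ λ (neg : d + 1 + i < n) → contra 0 (≥≡ e′ ⊹ ≥≡ e ⊹ neg) (solve (d ∷ i ∷ n ∷ x ∷ [])))

    label-room : ∀ i → i ≤ a → i + 1 ≤ n
    label-room i i≤a =
      ≮⇒≥ λ (neg : n < i + 1) → contra (3 + b) (≥≡ n≡ ⊹ i≤a ⊹ neg) (solve (a ∷ b ∷ i ∷ n ∷ []))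

    1≤n : 1 ≤ n
    1≤n = ≮⇒≥ λ (neg : n < 1) → contra (3 + a + b) (≥≡ n≡ ⊹ neg) (solve (a ∷ b ∷ n ∷ []))

  -- The truncated subtractions become sums here; `A-room` and `B-room` ensure that nothing is
  -- truncated.
  crown-step : ⌈ (n ∸ 4) /2⌉ ≤ a → ⌊ (n ∸ 4) /2⌋ ≤ b → ∀ {u v} → CrownEdge n u v → Step u v
  crown-step _ _ (fwd i _ _) = up refl
  crown-step _ _ (bwd i _ _) = down refl
  crown-step _ _ wrap₁       = wrap₁ refl K≡k
  crown-step _ _ wrap₂       = wrap₂ K≡k refl
  crown-step _ _ ex₁         = chord (A 0 z≤n (trans 2n≡1+L (sym (+-identityʳ (suc L))))
    (A-end (2 * n ∸ 2) 0 (trans (cong (_+ 2) (+-identityʳ (2 * n ∸ 2))) (m∸n+n≡m (A-room 0 z≤n)))))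
  crown-step _ _ ex₂         = chord (B 0 z≤n (trans (+-identityʳ (K n)) K≡k) refl)
  crown-step ≤a _ (chA i _ i≤) = chord (A i (≤-trans i≤ ≤a) (cong (_+ 3 * i) 2n≡1+L) (A-end d i d≡))
    where
    d : ℕ
    d = 2 * n ∸ 2 ∸ 2 * i
    room : 2 * i + 2 ≤ 2 * n
    room = A-room i (≤-trans i≤ ≤a)
    d≡ : d + 2 * i + 2 ≡ 2 * n
    d≡ = trans (cong (_+ 2) (m∸n+n≡m (m+n≤o⇒m≤o∸n (2 * i) room))) (m∸n+n≡m (m+n≤o⇒n≤o (2 * i) room))
  crown-step _ ≤b (chB i _ i≤) = chord (B i (≤-trans i≤ ≤b)
    (trans (m∸n+n≡m (subst (3 * i ≤_) (sym K≡k) (B-room i (≤-trans i≤ ≤b)))) K≡k) refl)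

  crown-exit : ⌈ (n ∸ 4) /2⌉ ≤ a → ⌊ (n ∸ 4) /2⌋ ≤ b → ∀ {l t} → OutTail n l t → Exit l t
  crown-exit _ _ o₁ = first refl K≡k
  crown-exit _ _ o₂ = second refl refl
  crown-exit _ _ o₃ = A 0 z≤n (trans (cong (_∸ 1) 2n≡1+L) (sym (+-identityʳ L)))
    (trans (+-identityʳ _) (m∸n+n≡m 1≤n))
  crown-exit _ _ o₄ = last refl 2n≡1+L
  crown-exit _ ≤b (o₅ i 1≤i i≤) = B i 1≤i (≤-trans i≤ ≤b)
    (trans (m∸n+n≡m (subst (3 * i ≤_) (sym 5n∸9≡) (m≤n⇒m≤1+n (B-room i (≤-trans i≤ ≤b))))) 5n∸9≡)
        refl
    where
    5n∸9≡ : 5 * n ∸ 9 ≡ suc k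
    5n∸9≡ = cong (_∸ 9) 5n≡10+k
  crown-exit ≤a _ (o₆ i _ i≤) = A i (≤-trans i≤ ≤a) (cong (λ z → z ∸ 1 + 3 * i) 2n≡1+L)
    (label-end (n ∸ 1 ∸ i) i (n ∸ 1)
      (m∸n+n≡m (m+n≤o⇒m≤o∸n i (label-room i (≤-trans i≤ ≤a)))) (m∸n+n≡m 1≤n))

  -- A passage descends r, …, 1 and ascends r + 1, …, L, then ascends L + 1, …, s and descends
  -- k, …, s + 1; these runs are joined by L → L + 1, by 1 → k and by one further edge p → q.
  -- It leaves at t.  The shapes first and last have no chord, and p → q repeats an edge of a run.
  data Shape (l r s p q t : ℕ) : Set where
    first : l ≡ 1 → r ≡ 0 → s ≡ k → p ≡ 1 → q ≡ 2 → t ≡ k → Shape l r s p q t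
    last  : l ≡ n → r ≡ L → s ≡ L → p ≡ 1 → q ≡ k → t ≡ suc L → Shape l r s p q t
    A     : ∀ i → i ≤ a → l + 1 + i ≡ n → suc r + 1 + 2 * i ≡ L → s ≡ L + 3 * i →
            p ≡ suc s → q ≡ suc r → t ≡ s → Shape l r s p q t
    B     : ∀ i → i ≤ b → l ≡ i + 2 → r ≡ 2 * i + 2 → s + 3 * i ≡ k →
            p ≡ s → q ≡ r → (s < k → t ≡ suc s) → (s ≡ k → t ≡ 1) → Shape l r s p q t

  data Path (r s p q u v : ℕ) : Set where
    in↓    : u ≡ suc v → 1 ≤ v → v < r → Path r s p q u v
    in↑    : v ≡ suc u → r < u → u < L → Path r s p q u v
    out↑   : v ≡ suc u → L ≤ u → u < s → Path r s p q u v
    out↓   : u ≡ suc v → s < v → v < k → Path r s p q u v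
    around : s < k → u ≡ 1 → v ≡ k → Path r s p q u v
    extra  : u ≡ p → v ≡ q → Path r s p q u v

  -- The label determines the path

  abstract
    1<n : 1 < n
    1<n = ≮⇒≥ λ (neg : n < suc 1) → contra (2 + a + b) (≥≡ n≡ ⊹ neg) (solve (a ∷ b ∷ n ∷ []))

    B-label-bound : ∀ l i → i ≤ b → l ≡ i + 2 → 2 ≤ l × l ≤ 2 + b
    B-label-bound l i i≤b e =
      (≮⇒≥ λ (neg : l < 2) → contra i (≥≡ e ⊹ neg) (solve (i ∷ l ∷ []))) ,
        ≮⇒≥ λ (neg : 2 + b < l) → contra 0 (≤≡ e ⊹ i≤b ⊹ neg) (solve (b ∷ i ∷ l ∷ []))

    2+b<n : 2 + b < n
    2+b<n = ≮⇒≥ λ (neg : n < suc (2 + b)) → contra (1 + a) (≥≡ n≡ ⊹ neg) (solve (a ∷ b ∷ n ∷ []))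

  -- The labels fall into disjoint blocks: 1 for `first`, 2 to b + 2 for `B`, b + 3 to n - 1 for
  -- `A`, and n for `last`. Within a block the label determines the index i, and i determines the
  -- rest.
  shape-unique : ∀ {l r s p q t r′ s′ p′ q′ t′} →
    Shape l r s p q t → Shape l r′ s′ p′ q′ t′ → r ≡ r′ × s ≡ s′ × p ≡ p′ × q ≡ q′
  shape-unique (first _ refl refl refl refl _) (first _ refl refl refl refl _) =
    refl , refl , refl , refl
  shape-unique (last _ refl refl refl refl _) (last _ refl refl refl refl _)   =
    refl , refl , refl , refl
  shape-unique {l} {r} {r′ = r′} (A i _ e x refl refl refl _) (A j _ e′ x′ refl refl refl _)
    with +-cancelˡ-≡ (l + 1) i j (trans e (sym e′))
  ... | refl with +-cancelʳ-≡ 1 (suc r) (suc r′) (+-cancelʳ-≡ (2 * i) _ _ (trans x (sym x′)))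
  ...   | refl = refl , refl , refl , refl
  shape-unique {s = s} {s′ = s′} (B i _ e refl x refl refl _ _) (B j _ e′ refl x′ refl refl _ _)
    with +-cancelʳ-≡ 2 i j (trans (sym e) e′)
  ... | refl with +-cancelʳ-≡ (3 * i) s s′ (trans x (sym x′))
  ...   | refl = refl , refl , refl , refl
  shape-unique {l} (first e _ _ _ _ _) (last e′ _ _ _ _ _) =
    ⊥-elim (n≮0 (≤-pred (≤-trans 1<n (≤-trans (≥≡ e′) (≤≡ e)))))
  shape-unique {l} (last e _ _ _ _ _) (first e′ _ _ _ _ _) =
    ⊥-elim (n≮0 (≤-pred (≤-trans 1<n (≤-trans (≥≡ e) (≤≡ e′)))))
  shape-unique {l} (first e _ _ _ _ _) (A i i≤a e′ _ _ _ _ _) =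
    ⊥-elim (n≮0 (<⇒≤ (≤-pred (≤-trans (s≤s (s≤s (s≤s z≤n)))
      (≤-trans (proj₁ (A-label-bound l i i≤a e′)) (≤≡ e))))))
  shape-unique {l} (A i i≤a e′ _ _ _ _ _) (first e _ _ _ _ _) =
    ⊥-elim (n≮0 (<⇒≤ (≤-pred (≤-trans (s≤s (s≤s (s≤s z≤n)))
      (≤-trans (proj₁ (A-label-bound l i i≤a e′)) (≤≡ e))))))
  shape-unique {l} (first e _ _ _ _ _) (B i i≤b e′ _ _ _ _ _ _) =
    ⊥-elim (n≮0 (≤-pred (≤-trans (proj₁ (B-label-bound l i i≤b e′)) (≤≡ e))))
  shape-unique {l} (B i i≤b e′ _ _ _ _ _ _) (first e _ _ _ _ _) =
    ⊥-elim (n≮0 (≤-pred (≤-trans (proj₁ (B-label-bound l i i≤b e′)) (≤≡ e))))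
  shape-unique {l} (last e _ _ _ _ _) (A i i≤a e′ _ _ _ _ _) =
    ⊥-elim (n≮n _ (≤-trans (proj₂ (A-label-bound l i i≤a e′)) (≥≡ e)))
  shape-unique {l} (A i i≤a e′ _ _ _ _ _) (last e _ _ _ _ _) =
    ⊥-elim (n≮n _ (≤-trans (proj₂ (A-label-bound l i i≤a e′)) (≥≡ e)))
  shape-unique {l} (last e _ _ _ _ _) (B i i≤b e′ _ _ _ _ _ _) =
    ⊥-elim (n≮n _ (≤-pred (≤-pred
        (≤-trans 2+b<n (≤-trans (≥≡ e) (proj₂ (B-label-bound l i i≤b e′)))))))
  shape-unique {l} (B i i≤b e′ _ _ _ _ _ _) (last e _ _ _ _ _) =
    ⊥-elim (n≮n _ (≤-pred (≤-pred
        (≤-trans 2+b<n (≤-trans (≥≡ e) (proj₂ (B-label-bound l i i≤b e′)))))))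
  shape-unique {l} (A i i≤a e _ _ _ _ _) (B j j≤b e′ _ _ _ _ _ _) =
    ⊥-elim (n≮n _ (≤-pred (≤-pred
        (≤-trans (proj₁ (A-label-bound l i i≤a e)) (proj₂ (B-label-bound l j j≤b e′))))))
  shape-unique {l} (B j j≤b e′ _ _ _ _ _ _) (A i i≤a e _ _ _ _ _) =
    ⊥-elim (n≮n _ (≤-pred (≤-pred
        (≤-trans (proj₁ (A-label-bound l i i≤a e)) (proj₂ (B-label-bound l j j≤b e′))))))

  -- The edges of a path cover the crown

  source-cases : ∀ {r s p q} u → r ≤ L → L ≤ s → s ≤ k → 1 ≤ u → u ≤ k →
    (Σ[ v ∈ ℕ ] 1 ≤ v × v ≤ k × Path r s p q u v) ⊎
    (u ≡ 1 × 1 ≤ r × s ≡ k) ⊎ (u ≡ L × r < L × s ≡ L) ⊎ (u ≡ s × L < s) ⊎ (u ≡ suc s × s < k)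
  source-cases {r} {s} (suc v) r≤L L≤s s≤k _ u≤k with ≤-<-connex (suc v) r | compare (suc v) L |
      compare (suc v) s
  ... | inj₁ v<r | _ | _ with v | compare s k
  ...   | suc v | _             = inj₁ (suc v , s≤s z≤n , <⇒≤ u≤k , in↓ refl (s≤s z≤n) v<r)
  ...   | zero  | inj₁ s<k        = inj₁ (k , 1≤k , ≤-refl , around s<k refl refl)
  ...   | zero  | inj₂ (inj₁ s≡k) = inj₂ (inj₁ (refl , v<r , s≡k))
  ...   | zero  | inj₂ (inj₂ k<s) = ⊥-elim (n≮n _ (≤-trans k<s s≤k))
  source-cases {r} {s} (suc v) r≤L L≤s s≤k _ u≤k | inj₂ r<u | inj₁ u<L | _ =
    inj₁ (suc (suc v) , s≤s z≤n , ≤-trans (m≤n+m _ 3) (≤-trans (s≤s (s≤s (s≤s u<L))) 3+L≤k) , in↑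
        refl r<u u<L)
  source-cases {r} {s} (suc v) r≤L L≤s s≤k _ u≤k | inj₂ r<u | inj₂ (inj₁ u≡L) | inj₁ u<s =
    inj₁ (suc (suc v) , s≤s z≤n , ≤-trans (m≤n+m _ 2) (≤-trans (s≤s (s≤s (s≤s (≤≡ u≡L)))) 3+L≤k) ,
        out↑ refl (≥≡ u≡L) u<s)
  source-cases {r} {s} (suc v) r≤L L≤s s≤k _ u≤k | inj₂ r<u | inj₂ (inj₁ u≡L) | inj₂ (inj₁ u≡s) =
    inj₂ (inj₂ (inj₁ (u≡L , ≤-trans r<u (≤≡ u≡L) , trans (sym u≡s) u≡L)))
  source-cases {r} {s} (suc v) r≤L L≤s s≤k _ u≤k | inj₂ r<u | inj₂ (inj₁ u≡L) | inj₂ (inj₂ s<u) =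
    ⊥-elim (n≮n _ (≤-trans (s≤s L≤s) (≤-trans s<u (≤≡ u≡L))))
  source-cases {r} {s} (suc v) r≤L L≤s s≤k _ u≤k | inj₂ r<u | inj₂ (inj₂ L<u) | inj₁ u<s =
    inj₁ (suc (suc v) , s≤s z≤n , ≤-trans u<s s≤k , out↑ refl (<⇒≤ L<u) u<s)
  source-cases {r} {s} (suc v) r≤L L≤s s≤k _ u≤k | inj₂ r<u | inj₂ (inj₂ L<u) | inj₂ (inj₁ u≡s) =
    inj₂ (inj₂ (inj₂ (inj₁ (u≡s , (≤-trans L<u (≤≡ u≡s))))))
  source-cases {r} {s} (suc v) r≤L L≤s s≤k _ u≤k | inj₂ r<u | inj₂ (inj₂ L<u) | inj₂ (inj₂ s<u)
    with m≤n⇒m<n∨m≡n s<u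
  ... | inj₁ (s≤s s<v) =
      inj₁ (v , ≤-trans (m≤n+m _ 6) (≤-pred (≤-trans (s≤s 7≤L) L<u)) , <⇒≤ u≤k , out↓ refl s<v u≤k)
  ... | inj₂ refl      = inj₂ (inj₂ (inj₂ (inj₂ (refl , u≤k))))

  target-cases : ∀ {r s p q} v → r ≤ L → L ≤ s → s ≤ k → 1 ≤ v → v ≤ k →
    (Σ[ u ∈ ℕ ] 1 ≤ u × u ≤ k × Path r s p q u v) ⊎ v ≡ r ⊎ (v ≡ suc r × v ≤ L)
  target-cases {r} {s} (suc u) r≤L L≤s s≤k 1≤v v≤k with compare (suc u) r | ≤-<-connex (suc u) L
  ... | inj₁ v<r | _ =
      inj₁ (suc (suc u) , s≤s z≤n , ≤-trans (m≤n+m _ 3)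
        (≤-trans (s≤s (s≤s (s≤s v<r))) (≤-trans (s≤s (s≤s (s≤s r≤L))) 3+L≤k)) , in↓ refl 1≤v v<r)
  ... | inj₂ (inj₁ v≡r) | _ = inj₂ (inj₁ v≡r)
  ... | inj₂ (inj₂ r<v) | inj₁ v≤L with m≤n⇒m<n∨m≡n r<v
  ...   | inj₁ (s≤s r<u) = inj₁ (u , ≤-trans (s≤s z≤n) r<u , <⇒≤ v≤k , in↑ refl r<u v≤L)
  ...   | inj₂ refl = inj₂ (inj₂ (refl , v≤L))
  target-cases {r} {s} (suc u) r≤L L≤s s≤k 1≤v v≤k | inj₂ (inj₂ r<v) | inj₂ L<v
    with ≤-<-connex (suc u) s | compare (suc u) k
  ... | inj₁ v≤s | _             =
      inj₁ (u , ≤-trans (m≤n+m _ 6) (≤-pred (≤-trans (s≤s 7≤L) L<v)) , <⇒≤ v≤k , out↑ refl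
        (≤-pred L<v) v≤s)
  ... | inj₂ s<v | inj₁ v<k        = inj₁ (suc (suc u) , s≤s z≤n , v<k , out↓ refl s<v v<k)
  ... | inj₂ s<v | inj₂ (inj₁ v≡k) = inj₁ (1 , ≤-refl , 1≤k , around (≤-trans s<v v≤k) refl v≡k)
  ... | inj₂ s<v | inj₂ (inj₂ k<v) = ⊥-elim (n≮n _ (≤-trans k<v v≤k))

  shape-bounds : ∀ {l r s p q t} → Shape l r s p q t → r ≤ L × L ≤ s × s ≤ k
  shape-bounds {s = s} (first _ refl refl _ _ _) = z≤n , ≤-trans (m≤n+m _ 3) 3+L≤k , ≤-refl
  shape-bounds {s = s} (last _ refl refl _ _ _)  = ≤-refl , ≤-refl , ≤-trans (m≤n+m _ 3) 3+L≤k
  shape-bounds {r = r} {s} (A i i≤a _ e e′ _ _ _)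
    with A-target (suc r) i i≤a e | A-bound s i i≤a e′
  ... | _ , r<L | L≤s , s≤m =
      ≤-trans (m≤n+m _ 2) r<L , L≤s , ≤-trans (m≤n+m _ 3) (≤-trans (s≤s (s≤s (s≤s s≤m))) 3+m≤k)
  shape-bounds {r = r} {s} (B i i≤b _ e e′ _ _ _ _)
    with B-target r i i≤b e | B-bound 0 s i i≤b e′
  ... | _ , r<L | m<s , s≤k =
      ≤-trans (m≤n+m _ 5) r<L , ≤-trans (m≤n+m _ 3) (≤-trans (s≤s (s≤s (s≤s L≤m))) m<s) , s≤k

  -- This replaces listing the path in order: successors in a cycle are unique, so an edge of the
  -- cycle that starts at a crown vertex other than t must be the edge of the path. The vertices
  -- without a successor in a run are settled by the shape: each is impossible, the source of the
  -- extra edge, or t.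
  source-cover : ∀ {l r s p q t} u → Shape l r s p q t → 1 ≤ u → u ≤ k →
    (Σ[ v ∈ ℕ ] 1 ≤ v × v ≤ k × Path r s p q u v) ⊎ u ≡ t
  source-cover {r = r} {s} {p} {q} u sh 1≤u u≤k with shape-bounds sh
  ... | r≤L , L≤s , s≤k with source-cases {r} {s} {p} {q} u r≤L L≤s s≤k 1≤u u≤k | sh
  ...   | inj₁ c | _ = inj₁ c
  ...   | inj₂ (inj₁ (refl , () , _)) | first _ refl _ _ _ _
  ...   | inj₂ (inj₁ (refl , _ , e)) | last _ _ e′ _ _ _ =
      ⊥-elim (n≮n _ (≤-trans (m≤n+m _ 2) (≤-trans 3+L≤k (≤-trans (≥≡ e) (≤≡ e′)))))
  ...   | inj₂ (inj₁ (refl , _ , e)) | A i i≤a _ _ e′ _ _ _ =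
      ⊥-elim (n≮n _ (≤-trans (m≤n+m _ 2)
        (≤-trans (s≤s (s≤s (s≤s (≥≡ e))))
        (≤-trans (s≤s (s≤s (s≤s (proj₂ (A-bound s i i≤a e′))))) 3+m≤k))))
  ...   | inj₂ (inj₁ (refl , _ , e)) | B _ _ _ _ _ _ _ _ t≡ = inj₂ (sym (t≡ e))
  ...   | inj₂ (inj₂ (inj₁ (_ , _ , e))) | first _ _ e′ _ _ _ =
      ⊥-elim (n≮n _ (≤-trans (m≤n+m _ 2) (≤-trans 3+L≤k (≤-trans (≥≡ e′) (≤≡ e)))))
  ...   | inj₂ (inj₂ (inj₁ (_ , r<L , e))) | last _ e′ _ _ _ _ =
      ⊥-elim (n≮n _ (≤-trans (s≤s (≥≡ e′)) r<L))
  ...   | inj₂ (inj₂ (inj₁ (e , _ , e′))) | A _ _ _ _ _ _ _ t≡ =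
      inj₂ (trans e (trans (sym e′) (sym t≡)))
  ...   | inj₂ (inj₂ (inj₁ (_ , _ , e))) | B i i≤b _ _ e′ _ _ _ _ =
      ⊥-elim (n≮n _ (≤-trans (m≤n+m _ 2)
        (≤-trans (s≤s (s≤s (s≤s L≤m))) (≤-trans (proj₁ (B-bound 0 s i i≤b e′)) (≤≡ e)))))
  ...   | inj₂ (inj₂ (inj₂ (inj₁ (e , _)))) | first _ _ e′ _ _ t≡ =
      inj₂ (trans e (trans e′ (sym t≡)))
  ...   | inj₂ (inj₂ (inj₂ (inj₁ (_ , L<s)))) | last _ _ e _ _ _ =
      ⊥-elim (n≮n _ (≤-trans L<s (≤≡ e)))
  ...   | inj₂ (inj₂ (inj₂ (inj₁ (e , _)))) | A _ _ _ _ _ _ _ t≡ = inj₂ (trans e (sym t≡))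
  ...   | inj₂ (inj₂ (inj₂ (inj₁ (e , _)))) | B i i≤b _ e′ _ p≡ q≡ _ _ with B-target r i i≤b e′
  ...     | 2≤r , r<L =
      inj₁ (q , <⇒≤ (≤-trans 2≤r (≥≡ q≡)) , ≤-trans (m≤n+m _ 8)
        (≤-trans (s≤s (s≤s (s≤s (s≤s (s≤s (s≤s (s≤s (s≤s (≤≡ q≡)))))))))
        (≤-trans (s≤s (s≤s (s≤s r<L))) 3+L≤k)) , extra (trans e (sym p≡)) refl)
  source-cover {r = r} {s} {p} {q} u sh 1≤u u≤k | r≤L , L≤s , s≤k | inj₂
      (inj₂ (inj₂ (inj₂ (_ , s<k)))) | first _ _ e _ _ _ = ⊥-elim (n≮n _ (≤-trans (s≤s (≥≡ e)) s<k))
  source-cover {r = r} {s} {p} {q} u sh 1≤u u≤k | r≤L , L≤s , s≤k | inj₂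
      (inj₂ (inj₂ (inj₂ (e , _)))) | last _ _ e′ _ _ t≡ = inj₂
      (trans e (trans (cong suc e′) (sym t≡)))
  source-cover {r = r} {s} {p} {q} u sh 1≤u u≤k | r≤L , L≤s , s≤k | inj₂
      (inj₂ (inj₂ (inj₂ (e , _)))) | A i i≤a _ e′ _ p≡ q≡ _ with A-target (suc r) i i≤a e′
  ... | 6≤r , r<L =
      inj₁ (q , ≤-trans (m≤n+m _ 5) (≤-trans 6≤r (≥≡ q≡)) , ≤-trans (m≤n+m _ 4)
        (≤-trans (s≤s (s≤s (s≤s (s≤s (≤≡ q≡))))) (≤-trans (s≤s (s≤s (s≤s r<L))) 3+L≤k)) , extra
        (trans e (sym p≡)) refl)
  source-cover {r = r} {s} {p} {q} u sh 1≤u u≤k | r≤L , L≤s , s≤k | inj₂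
      (inj₂ (inj₂ (inj₂ (e , s<k)))) | B _ _ _ _ _ _ _ t≡ _ = inj₂ (trans e (sym (t≡ s<k)))

  abstract
    head-last : ∀ h → suc h ≡ 2 * n → h ≡ L
    head-last h e =
      ≤-antisym (≮⇒≥ λ (neg : L < h) → contra 0 (≥≡ L≡ ⊹ 2 ⊠ (≤≡ n≡) ⊹ ≤≡ e ⊹ neg)
        (solve (L ∷ a ∷ b ∷ h ∷ n ∷ [])))
        (≮⇒≥ λ (neg : h < L) → contra 0 (≤≡ L≡ ⊹ 2 ⊠ (≥≡ n≡) ⊹ ≥≡ e ⊹ neg)
        (solve (L ∷ a ∷ b ∷ h ∷ n ∷ [])))

    head-A : ∀ h r i l → l + 1 + i ≡ n → suc r + 1 + 2 * i ≡ L → suc h ≡ 2 * l → h ≡ r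
    head-A h r i l e e′ e″ =
      ≤-antisym (≮⇒≥ λ (neg : r < h) → contra 0
        (≥≡ L≡ ⊹ 2 ⊠ (≤≡ n≡) ⊹ ≤≡ e″ ⊹ ≥≡ e′ ⊹ 2 ⊠ (≤≡ e) ⊹ neg)
        (solve (L ∷ a ∷ b ∷ h ∷ i ∷ l ∷ n ∷ r ∷ [])))
        (≮⇒≥ λ (neg : h < r) → contra 0 (≤≡ L≡ ⊹ 2 ⊠ (≥≡ n≡) ⊹ ≥≡ e″ ⊹ ≤≡ e′ ⊹ 2 ⊠ (≥≡ e) ⊹ neg)
        (solve (L ∷ a ∷ b ∷ h ∷ i ∷ l ∷ n ∷ r ∷ [])))

    head-B : ∀ h r i l → l ≡ i + 2 → r ≡ 2 * i + 2 → suc h ≡ 2 * l → h ≡ suc r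
    head-B h r i l e e′ e″ =
      ≤-antisym (≮⇒≥ λ (neg : suc r < h) → contra 0 (≤≡ e″ ⊹ ≥≡ e′ ⊹ 2 ⊠ (≤≡ e) ⊹ neg)
        (solve (h ∷ i ∷ l ∷ r ∷ [])))
        (≮⇒≥ λ (neg : h < suc r) → contra 0 (≥≡ e″ ⊹ ≤≡ e′ ⊹ 2 ⊠ (≥≡ e) ⊹ neg)
        (solve (h ∷ i ∷ l ∷ r ∷ [])))

  target-cover : ∀ {l r s p q t h} v → Shape l r s p q t → suc h ≡ 2 * l → 1 ≤ v → v ≤ k →
    (Σ[ u ∈ ℕ ] 1 ≤ u × u ≤ k × Path r s p q u v) ⊎ v ≡ h
  target-cover {l} {r} {s} {p} {q} {h = h} v sh h≡ 1≤v v≤k with shape-bounds sh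
  ... | r≤L , L≤s , s≤k with target-cases {r} {s} {p} {q} v r≤L L≤s s≤k 1≤v v≤k | sh
  ...   | inj₁ c | _ = inj₁ c
  ...   | inj₂ (inj₁ v≡r) | first _ e _ _ _ _ = ⊥-elim (n≮0 (≤-trans 1≤v (≤-trans (≤≡ v≡r) (≤≡ e))))
  ...   | inj₂ (inj₁ v≡r) | last refl e _ _ _ _ = inj₂ (trans v≡r (trans e (sym (head-last h h≡))))
  ...   | inj₂ (inj₁ v≡r) | A i i≤a e e′ _ _ _ _ = inj₂ (trans v≡r (sym (head-A h r i l e e′ h≡)))
  ...   | inj₂ (inj₁ v≡r) | B i i≤b _ _ e p≡ q≡ _ _ =
      inj₁ (p , ≤-trans (m≤n+m _ 6) (≤-trans 7≤L (≤-trans L≤s (≥≡ p≡))) , ≤-trans (≤≡ p≡) s≤k ,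
        extra refl (trans v≡r (sym q≡)))
  ...   | inj₂ (inj₂ (v≡ , _)) | first refl refl _ _ _ _ = inj₂ (trans v≡ (sym (suc-injective h≡)))
  ...   | inj₂ (inj₂ (v≡ , v≤L)) | last _ e _ _ _ _ =
      ⊥-elim (n≮n _ (≤-trans (s≤s (≥≡ e)) (≤-trans (≥≡ v≡) v≤L)))
  ...   | inj₂ (inj₂ (v≡ , _)) | A i i≤a _ _ e p≡ q≡ _ =
      inj₁ (p , ≤-trans (s≤s z≤n) (≥≡ p≡) , ≤-trans (m≤n+m _ 2)
        (≤-trans (s≤s (s≤s (≤≡ p≡)))
        (≤-trans (s≤s (s≤s (s≤s (proj₂ (A-bound s i i≤a e))))) 3+m≤k)) , extra refl
        (trans v≡ (sym q≡)))
  ...   | inj₂ (inj₂ (v≡ , _)) | B i i≤b e e′ _ _ _ _ _ =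
      inj₂ (trans v≡ (sym (head-B h r i l e e′ h≡)))

  -- A Hamiltonian cycle as seen from the crown

  record Cycle : Set₁ where
    field
      R : ℕ → ℕ → Set
      inTail outHead : ℕ → ℕ
      -- The original relation of tails is carried along, since the translation goes only from
      -- `OutTail` to `Exit` and the theorem has to return an `OutTail`.
      T : ℕ → ℕ → Set

    Next : ℕ → Set
    Next u = Σ[ v ∈ ℕ ] R u v × ((1 ≤ v × v ≤ k × Step u v) ⊎
      (k < v × Σ[ l ∈ ℕ ] T l u × Exit l u × v ≡ outHead l))
    Prev : ℕ → Set
    Prev v = Σ[ u ∈ ℕ ] R u v × ((1 ≤ u × u ≤ k × Step u v) ⊎
      (k < u × Σ[ l ∈ ℕ ] 1 ≤ l × l ≤ n × suc v ≡ 2 * l × u ≡ inTail l))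

    field
      fun : ∀ {u v w} → R u v → R u w → v ≡ w
      inj : ∀ {u v w} → R u w → R v w → u ≡ v
      next : ∀ u → 1 ≤ u → u ≤ k → Next u
      prev : ∀ v → 1 ≤ v → v ≤ k → Prev v
      -- A nonempty set of crown vertices closed under successors would trap the cycle inside the
      -- crown. Every argument that excludes a small cycle goes through this field.
      acyclic : ∀ (P : ℕ → Set) → (∀ {u} → P u → 1 ≤ u × u ≤ k) →
        (∀ u → P u → Σ[ v ∈ ℕ ] R u v × P v) → ∀ {u} → P u → ⊥

  module Trace (C : Cycle) where
    open Cycle C

    no2 : ∀ {u v} → R u v → R v u → 1 ≤ u → u ≤ k → 1 ≤ v → v ≤ k → ⊥
    no2 {u} {v} uv vu 1≤u u≤k 1≤v v≤k = acyclic P range closed (inj₁ refl)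
      where
      P : ℕ → Set
      P w = w ≡ u ⊎ w ≡ v
      range : ∀ {w} → P w → 1 ≤ w × w ≤ k
      range (inj₁ refl) = 1≤u , u≤k
      range (inj₂ refl) = 1≤v , v≤k
      closed : ∀ w → P w → Σ[ x ∈ ℕ ] R w x × P x
      closed _ (inj₁ refl) = v , uv , inj₂ refl
      closed _ (inj₂ refl) = u , vu , inj₁ refl

    Leaves Enters : ℕ → ℕ → Set
    Leaves l t = k < outHead l × T l t × R t (outHead l)
    Enters l h = 1 ≤ l × l ≤ n × suc h ≡ 2 * l × k < inTail l × R (inTail l) h

    record Passage : Set where
      field
        {l r s p q t h} : ℕ
        shape   : Shape l r s p q t
        follows : ∀ {u v} → Path r s p q u v → R u v
        enters  : Enters l h
        leaves  : Leaves l t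

    -- The boundary values of r and s are allowed and make one run empty. `leaveLow` and `leaveTop`
    -- pin down r there: 1 → 2 forces r = 0, and L → L - 1 forces r = L. `outUp` starts at L because
    -- the outer runs come from the way vertices are entered, and L + 1 is entered from L if it
    -- belongs to the ascending run.
    record Runs (r s : ℕ) : Set where
      field
        r≤L      : r ≤ L
        L≤s      : L ≤ s
        s≤k      : s ≤ k
        inDown   : ∀ w → 1 ≤ w → w < r → R (suc w) w
        inUp     : ∀ w → r < w → w < L → R w (suc w)
        outUp    : ∀ w → L ≤ w → w < s → R w (suc w)
        outDown  : ∀ w → s < w → w < k → R (suc w) w
        wrap     : s < k → R 1 k
        leaveLow : 1 ≤ r → R 1 2 → ⊥
        leaveTop : ∀ w → r < L → suc w ≡ L → R L w → ⊥

    -- Strictly between 1 and L neither a chord nor an exit starts, so only the neighbours remain.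
    -- Quantifying over x with `w ≡ suc x` stands in for a predecessor function.
    innerStep : ∀ w → 2 ≤ w → w < L → R w (suc w) ⊎ (∀ x → w ≡ suc x → R w x)
    innerStep w 2≤w w<L =
      split (next w (<⇒≤ 2≤w) (≤-trans (m≤n+m _ 4) (≤-trans (s≤s (s≤s (s≤s w<L))) 3+L≤k)))
      where
      split : Next w → R w (suc w) ⊎ (∀ x → w ≡ suc x → R w x)
      split (v , wv , inj₁ (_ , _ , up refl))   = inj₁ wv
      split (v , wv , inj₁ (_ , _ , down refl)) = inj₂ λ { x refl → wv }
      split (v , wv , inj₁ (_ , _ , wrap₁ e _)) = ⊥-elim (n≮0 (≤-pred (≤-trans 2≤w (≤≡ e))))
      split (v , wv , inj₁ (_ , _ , wrap₂ e _)) =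
        ⊥-elim (n≮n _ (≤-trans (m≤n+m _ 3) (≤-trans (s≤s 3+L≤k) (≤-trans (s≤s (≥≡ e)) w<L))))
      split (v , wv , inj₁ (_ , _ , chord c)) with chord-source c
      ... | L<w , _ = ⊥-elim (n≮n _ (<⇒≤ (≤-trans (s≤s L<w) w<L)))
      split (v , wv , inj₂ (_ , l , _ , e , _)) with exit-tail e
      ... | inj₁ w≡1 = ⊥-elim (n≮0 (≤-pred (≤-trans 2≤w (≤≡ w≡1))))
      ... | inj₂ L≤w = ⊥-elim (n≮n _ (≤-trans (s≤s L≤w) w<L))

    -- Above L it is the predecessors that are under control, since chords and incoming edges end at
    -- or below L. The pair separates v = k, whose upper neighbour is 1.
    outerStep : ∀ v → L < v → v ≤ k →
      ((v < k → R (suc v) v) × (v ≡ k → R 1 k)) ⊎ (∀ w → v ≡ suc w → R w v)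
    outerStep v L<v v≤k = split (prev v (≤-trans (m≤n+m _ 7) (≤-trans (s≤s 7≤L) L<v)) v≤k)
      where
      split : Prev v → ((v < k → R (suc v) v) × (v ≡ k → R 1 k)) ⊎ (∀ w → v ≡ suc w → R w v)
      split (u , uv , inj₁ (_ , _ , up refl)) = inj₂ λ { w refl → uv }
      split (u , uv , inj₁ (_ , u≤k , down refl)) =
        inj₁ ((λ _ → uv) , λ e → ⊥-elim (n≮n _ (≤-trans (s≤s (≥≡ e)) u≤k)))
      split (u , uv , inj₁ (_ , _ , wrap₁ refl e)) =
        inj₁ ((λ v<k → ⊥-elim (n≮n _ (≤-trans (s≤s (≥≡ e)) v<k))) , λ { refl → uv })
      split (u , uv , inj₁ (_ , _ , wrap₂ e e′)) =
        ⊥-elim (n≮0 (≤-trans (m≤n+m _ 6) (≤-pred (≤-trans (s≤s 7≤L) (≤-trans L<v (≤≡ e′))))))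
      split (u , uv , inj₁ (_ , _ , chord c)) with chord-target c
      ... | _ , v<L = ⊥-elim (n≮n _ (<⇒≤ (≤-trans (s≤s L<v) v<L)))
      split (u , uv , inj₂ (_ , l , _ , l≤n , e , _)) =
        ⊥-elim (n≮n _ (≤-trans L<v (head≤L v l e l≤n)))

    InnerRuns : Set
    InnerRuns = Σ[ r ∈ ℕ ] r ≤ L ×
      (∀ w → 1 ≤ w → w < r → R (suc w) w) × (∀ w → r < w → w < L → R w (suc w)) ×
      (1 ≤ r → R 1 2 → ⊥) × (∀ w → r < L → suc w ≡ L → R L w → ⊥)

    -- The threshold covers only 2, ..., L - 1, because 1 and L have further ways to leave. If 1
    -- goes to 2, every inner vertex must ascend, and if L goes to L - 1, every one must descend;
    -- otherwise a 2-cycle appears at that end.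
    extend : Σ[ m ∈ ℕ ] 2 ≤ m × m ≤ L ×
      (∀ w → 2 ≤ w → w < m → ∀ x → w ≡ suc x → R w x) × (∀ w → m ≤ w → w < L → R w (suc w)) →
      Next 1 → Next L → InnerRuns
    extend (zero , () , _)
    extend (suc r , s≤s 1≤r , r<L , dns , ups) (x , 1x , _) (y , Ly , _) with x ≟ 2 | suc y ≟ L
    ... | yes refl | _ = 0 , z≤n , (λ _ _ ()) , ups′ , (λ ()) , top
      where
      ups′ : ∀ w → 0 < w → w < L → R w (suc w)
      ups′ w 0<w w<L with compare w 1 | ≤-<-connex r 1
      ... | inj₁ w<1 | _ = ⊥-elim (n≮0 (≤-pred (≤-trans (s≤s 0<w) w<1)))
      ... | inj₂ (inj₁ refl) | _ = 1x
      ... | inj₂ (inj₂ 1<w) | inj₁ r≤1 = ups w (≤-trans (s≤s r≤1) 1<w) w<L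
      ... | inj₂ (inj₂ 1<w) | inj₂ 1<r =
          ⊥-elim (no2 1x (dns 2 ≤-refl (s≤s 1<r) 1 refl) (s≤s z≤n) 1≤k (s≤s z≤n)
            (≤-trans (m≤n+m _ 8) (≤-trans (s≤s (s≤s (s≤s 7≤L))) 3+L≤k)))
      top : ∀ w → 0 < L → suc w ≡ L → R L w → ⊥
      top w _ e Lw =
        no2 Lw (subst (R w) e (ups′ w (≤-trans (m≤n+m _ 5) (≤-pred (≤-trans 7≤L (≥≡ e)))) (≤≡ e)))
          (≤-trans (m≤n+m _ 6) 7≤L) (≤-trans (m≤n+m _ 3) 3+L≤k)
          (≤-trans (m≤n+m _ 5) (≤-pred (≤-trans 7≤L (≥≡ e))))
          (≤-trans (m≤n+m _ 4) (≤-trans (s≤s (s≤s (s≤s (≤≡ e)))) 3+L≤k))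
    ... | no x≢2 | yes y≡ =
        L , ≤-refl , dns′ , (λ w p q → ⊥-elim (n≮n _ (<⇒≤ (≤-trans (s≤s p) q)))) , low , λ w
          p → ⊥-elim (n≮n _ p)
      where
      low : 1 ≤ L → R 1 2 → ⊥
      low _ 1→2 = x≢2 (fun 1x 1→2)
      dns′ : ∀ w → 1 ≤ w → w < L → R (suc w) w
      dns′ w 1≤w w<L with compare (suc w) L
      ... | inj₂ (inj₁ e) =
          subst (λ z → R z w) (sym e) (subst (R L) (suc-injective (trans y≡ (sym e))) Ly)
      ... | inj₂ (inj₂ L<) = ⊥-elim (n≮n _ (≤-trans L< w<L))
      ... | inj₁ sw<L with ≤-<-connex (suc (suc r)) L
      ...   | inj₂ L< = dns (suc w) (s≤s 1≤w) (≤-pred (≤-trans (s≤s sw<L) L<)) w refl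
      ...   | inj₁ r< =
          ⊥-elim (no2 Ly (subst (R y) y≡ (ups y (≤-pred (≤-trans r< (≥≡ y≡))) (≤≡ y≡)))
            (≤-trans (m≤n+m _ 6) 7≤L) (≤-trans (m≤n+m _ 3) 3+L≤k)
            (≤-trans (m≤n+m _ 5) (≤-pred (≤-trans 7≤L (≥≡ y≡))))
            (≤-trans (m≤n+m _ 4) (≤-trans (s≤s (s≤s (s≤s (≤≡ y≡)))) 3+L≤k)))
    ... | no x≢2 | no y≢ = r , <⇒≤ r<L , dns′ , ups , low , top
      where
      dns′ : ∀ w → 1 ≤ w → w < r → R (suc w) w
      dns′ w 1≤w w<r = dns (suc w) (s≤s 1≤w) (s≤s w<r) w refl
      low : 1 ≤ r → R 1 2 → ⊥
      low _ 1→2 = x≢2 (fun 1x 1→2)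
      top : ∀ w → r < L → suc w ≡ L → R L w → ⊥
      top w _ e Lw = y≢ (trans (cong suc (fun Ly Lw)) e)

    inner : InnerRuns
    inner =
      extend (threshold 2 L (≤-trans (m≤n+m _ 5) 7≤L) innerStep
        (λ w 2≤w w<L u d → no2 u (d w refl) (<⇒≤ 2≤w)
        (≤-trans (m≤n+m _ 5) (≤-trans (s≤s (s≤s (s≤s w<L))) 3+L≤k)) (s≤s z≤n)
        (≤-trans (m≤n+m _ 4) (≤-trans (s≤s (s≤s (s≤s w<L))) 3+L≤k))))
      (next 1 ≤-refl 1≤k) (next L (≤-trans (m≤n+m _ 6) 7≤L) (≤-trans (m≤n+m _ 3) 3+L≤k))

    runs : Σ[ r ∈ ℕ ] Σ[ s ∈ ℕ ] Runs r s
    runs = join inner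
      -- The threshold is s + 1: the first vertex entered from above, or k + 1 if there is none.
      (threshold (suc L) (suc k) (≤-trans (m≤n+m _ 3) (s≤s 3+L≤k))
          (λ { v p (s≤s q) → outerStep v p q })
        (λ v p q (u , _) d → no2 (u (≤-pred q)) (d v refl) (s≤s z≤n) (≤-pred q)
            (≤-trans (m≤n+m _ 7) (≤-trans (s≤s 7≤L) p)) (<⇒≤ (≤-pred q))))
      where
      join : InnerRuns → Σ[ m ∈ ℕ ] L < m × m ≤ suc k ×
        (∀ w → L < w → w < m → ∀ x → w ≡ suc x → R x w) ×
        (∀ w → m ≤ w → w < suc k → (w < k → R (suc w) w) × (w ≡ k → R 1 k)) →
        Σ[ r ∈ ℕ ] Σ[ s ∈ ℕ ] Runs r s
      join _ (zero , () , _)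
      join (r , r≤L , dns , ups , low , top) (suc s , s≤s L≤s , s≤s s≤k , odn , oup) =
        r , s , record
        { r≤L = r≤L ; L≤s = L≤s ; s≤k = s≤k ; inDown = dns ; inUp = ups
        ; outUp = λ w p q → odn (suc w) (s≤s p) (s≤s q) w refl
        ; outDown = λ w p q → proj₁ (oup w p (<⇒≤ (s≤s q))) q
        ; wrap = λ s<k → proj₂ (oup k s<k ≤-refl) refl
        ; leaveLow = low ; leaveTop = top }

    -- The free ends of the runs

    module Analysis {r s} (run : Runs r s) where
      open Runs run

      noWrap : s ≡ k → R 1 k → ⊥
      noWrap s≡k 1k = rises (2 + m + 3 * b) k≡
        where
        rises : ∀ w → k ≡ suc w → ⊥
        rises w e =
          case inj 1k (subst (R w) (sym e)
            (outUp w (≤-trans (m≤n+m _ 2) (≤-pred (≤-trans 3+L≤k (≤≡ e))))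
            (≤-trans (≥≡ e) (≥≡ s≡k))))
            of λ 1≡w → (⊥-elim (n≮0 (≤-trans (m≤n+m _ 7)
            (≤-pred (≤-pred (≤-trans (s≤s (s≤s (s≤s 7≤L)))
            (≤-trans 3+L≤k (≤-trans (≤≡ e) (s≤s (≥≡ 1≡w))))))))))

      -- These list what the runs leave open: the successors of s and s + 1 and the predecessors of
      -- r + 1 and r. The final alternatives are the boundary edges k → 1 and L + 1 → L.
      UpEnd DownEnd UpStart DownStart : Set
      UpEnd = Σ[ v ∈ ℕ ] R s v × (Chord s v ⊎
        (k < v × Σ[ l ∈ ℕ ] T l s × Exit l s × v ≡ outHead l) ⊎ (s ≡ k × v ≡ 1))
      DownEnd = Σ[ v ∈ ℕ ] R (suc s) v × (Chord (suc s) v ⊎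
        (k < v × Σ[ l ∈ ℕ ] T l (suc s) × Exit l (suc s) × v ≡ outHead l) ⊎ (s ≡ L × v ≡ L))
      UpStart = Σ[ u ∈ ℕ ] R u (suc r) × (Chord u (suc r) ⊎
        (k < u × Σ[ l ∈ ℕ ] 1 ≤ l × l ≤ n × suc (suc r) ≡ 2 * l × u ≡ inTail l) ⊎
        (r ≡ 0 × u ≡ k) ⊎ (suc r ≡ L × u ≡ suc L))
      DownStart = Σ[ u ∈ ℕ ] R u r × (Chord u r ⊎
        (k < u × Σ[ l ∈ ℕ ] 1 ≤ l × l ≤ n × suc r ≡ 2 * l × u ≡ inTail l) ⊎
        (r ≡ 1 × u ≡ k) ⊎ (r ≡ L × u ≡ suc L))

      upEnd : L < s → UpEnd
      upEnd L<s = split (next s (≤-trans (m≤n+m _ 7) (≤-trans (s≤s 7≤L) L<s)) s≤k)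
        where
        last-up : R s (suc s) → suc s ≤ k → ⊥
        last-up ss s<k with compare (suc s) k
        ... | inj₁ 1+s<k      = case inj ss (outDown (suc s) ≤-refl 1+s<k) of λ ()
        ... | inj₂ (inj₁ e)   =
            case inj ss (subst (R 1) (sym e) (wrap s<k))
              of λ s≡1 → (⊥-elim (n≮0 (≤-trans (m≤n+m _ 6)
              (≤-pred (≤-trans (s≤s 7≤L) (≤-trans L<s (≤≡ s≡1)))))))
        ... | inj₂ (inj₂ k<s) = n≮n _ (≤-trans k<s s<k)
        split : Next s → UpEnd
        split (v , sv , inj₂ out) = v , sv , inj₂ (inj₁ out)
        split (v , sv , inj₁ (_ , _ , chord c)) = v , sv , inj₁ c
        split (v , sv , inj₁ (_ , _ , wrap₂ e e′)) = v , sv , inj₂ (inj₂ (e , e′))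
        split (v , sv , inj₁ (_ , _ , wrap₁ e _)) =
          ⊥-elim (n≮0 (≤-trans (m≤n+m _ 6) (≤-pred (≤-trans (s≤s 7≤L) (≤-trans L<s (≤≡ e))))))
        split (v , sv , inj₁ (1≤v , v≤k , down e)) =
          ⊥-elim (no2 sv (subst (R v) (sym e) (outUp v (≤-pred (≤-trans L<s (≤≡ e))) (≥≡ e)))
              (≤-trans (m≤n+m _ 7) (≤-trans (s≤s 7≤L) L<s)) s≤k 1≤v v≤k)
        split (v , sv , inj₁ (_ , v≤k , up refl)) = ⊥-elim (last-up sv v≤k)

      downEnd : s < k → DownEnd
      downEnd s<k = split (next (suc s) (s≤s z≤n) s<k)
        where
        above : ∀ w → L < w → w ≤ s → R (suc s) w → ⊥
        above (suc w) L<w w<s sw =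
          case inj sw (outUp w (≤-pred L<w) w<s)
            of λ e → (⊥-elim (n≮n _ (<⇒≤ (≤-trans (s≤s (≤≡ e)) w<s))))
        split : Next (suc s) → DownEnd
        split (v , sv , inj₂ out) = v , sv , inj₂ (inj₁ out)
        split (v , sv , inj₁ (_ , _ , chord c)) = v , sv , inj₁ c
        split (v , sv , inj₁ (_ , v≤k , up refl)) =
          ⊥-elim (no2 sv (outDown (suc s) ≤-refl v≤k) (s≤s z≤n) (<⇒≤ v≤k) (s≤s z≤n) v≤k)
        split (v , sv , inj₁ (_ , _ , wrap₁ e _)) =
          ⊥-elim (n≮0 (≤-trans (m≤n+m _ 6) (≤-pred (≤-trans (s≤s 7≤L) (≤-trans (s≤s L≤s) (≤≡ e))))))
        split (v , sv , inj₁ (_ , _ , wrap₂ e refl)) =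
          ⊥-elim (no2 (wrap s<k) (subst (λ z → R z 1) e sv) (s≤s z≤n) 1≤k 1≤k ≤-refl)
        split (v , sv , inj₁ (_ , _ , down refl)) with compare s L
        ... | inj₁ s<L        = ⊥-elim (n≮n _ (≤-trans (s≤s L≤s) s<L))
        ... | inj₂ (inj₁ e)   = s , sv , inj₂ (inj₂ (e , e))
        ... | inj₂ (inj₂ L<s) = ⊥-elim (above s L<s ≤-refl sv)

      downStart : 1 ≤ r → DownStart
      downStart 1≤r = split (prev r 1≤r (≤-trans (m≤n+m _ 3) (≤-trans (s≤s (s≤s (s≤s r≤L))) 3+L≤k)))
        where
        split : Prev r → DownStart
        split (u , ur , inj₂ ins) = u , ur , inj₂ (inj₁ ins)
        split (u , ur , inj₁ (_ , _ , chord c)) = u , ur , inj₁ c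
        split (u , ur , inj₁ (1≤u , _ , up e)) =
          ⊥-elim (no2 ur (subst (λ z → R z u) (sym e) (inDown u 1≤u (≥≡ e))) 1≤u
              (≤-trans (m≤n+m _ 4) (≤-trans (s≤s (s≤s (s≤s (≥≡ e))))
              (≤-trans (s≤s (s≤s (s≤s r≤L))) 3+L≤k))) 1≤r
              (≤-trans (m≤n+m _ 3) (≤-trans (s≤s (s≤s (s≤s r≤L))) 3+L≤k)))
        split (u , ur , inj₁ (_ , _ , wrap₁ e e′)) =
          ⊥-elim (n≮n _ (≤-trans (m≤n+m _ 2) (≤-trans 3+L≤k (≤-trans (≥≡ e′) r≤L))))
        split (u , ur , inj₁ (_ , _ , wrap₂ e e′)) = u , ur , inj₂ (inj₂ (inj₁ (e′ , e)))
        split (u , ur , inj₁ (_ , _ , down refl)) with compare (suc r) L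
        ... | inj₁ u<L        = case fun ur (inUp (suc r) ≤-refl u<L) of λ ()
        ... | inj₂ (inj₁ e)   = ⊥-elim (leaveTop r (≤≡ e) e (subst (λ z → R z r) e ur))
        ... | inj₂ (inj₂ L<u) =
            u , ur , inj₂ (inj₂ (inj₂ ((≤-antisym r≤L (≤-pred L<u)) , (≤-antisym (s≤s r≤L) L<u))))

      upStart : r < L → UpStart
      upStart r<L =
        split (prev (suc r) (s≤s z≤n) (≤-trans (m≤n+m _ 3) (≤-trans (s≤s (s≤s (s≤s r<L))) 3+L≤k)))
        where
        below : ∀ w → 1 ≤ w → w ≤ r → R w (suc w) → ⊥
        below 1 _ 1≤r ww = leaveLow 1≤r ww
        below (suc (suc w)) _ w<r ww = case fun ww (inDown (suc w) (s≤s z≤n) w<r) of λ ()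
        split : Prev (suc r) → UpStart
        split (u , ur , inj₂ ins) = u , ur , inj₂ (inj₁ ins)
        split (u , ur , inj₁ (_ , _ , chord c)) = u , ur , inj₁ c
        split (u , ur , inj₁ (_ , _ , wrap₁ e e′)) =
          ⊥-elim (n≮n _ (≤-trans (m≤n+m _ 2) (≤-trans 3+L≤k (≤-trans (≥≡ e′) r<L))))
        split (u , ur , inj₁ (_ , _ , wrap₂ e e′)) =
          u , ur , inj₂ (inj₂ (inj₁ (suc-injective e′ , e)))
        split (u , ur , inj₁ (1≤u , _ , up refl)) = ⊥-elim (below u 1≤u ≤-refl ur)
        split (u , ur , inj₁ (_ , _ , down refl)) with compare (suc r) L
        ... | inj₁ 1+r<L     =
            ⊥-elim (no2 ur (inUp (suc r) ≤-refl 1+r<L) (s≤s z≤n)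
              (≤-trans (m≤n+m _ 3) (≤-trans (s≤s (s≤s (s≤s 1+r<L))) 3+L≤k)) (s≤s z≤n)
              (≤-trans (m≤n+m _ 4) (≤-trans (s≤s (s≤s (s≤s 1+r<L))) 3+L≤k)))
        ... | inj₂ (inj₁ e)  = u , ur , inj₂ (inj₂ (inj₂ (e , cong suc e)))
        ... | inj₂ (inj₂ L<) = ⊥-elim (n≮n _ (≤-trans L< r<L))

      follow : ∀ {p q} → R p q → ∀ {u v} → Path r s p q u v → R u v
      follow pq (in↓ refl x y)       = inDown _ x y
      follow pq (in↑ refl x y)       = inUp _ x y
      follow pq (out↑ refl x y)      = outUp _ x y
      follow pq (out↓ refl x y)      = outDown _ x y
      follow pq (around x refl refl) = wrap x
      follow pq (extra refl refl)    = pq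

      -- The ascending runs already join r + 1 to s by way of L → L + 1, so this edge would close
      -- them into a cycle.
      noLoopUp : r < s → R s (suc r) → ⊥
      noLoopUp r<s sr = acyclic P range closed (r<s , ≤-refl)
        where
        P : ℕ → Set
        P w = r < w × w ≤ s
        range : ∀ {w} → P w → 1 ≤ w × w ≤ k
        range {w} (r<w , w≤s) = ≤-trans (s≤s z≤n) r<w , ≤-trans w≤s s≤k
        closed : ∀ w → P w → Σ[ x ∈ ℕ ] R w x × P x
        closed w (r<w , w≤s) with compare w s | ≤-<-connex L w
        ... | inj₁ w<s         | inj₁ L≤w = suc w , outUp w L≤w w<s , <⇒≤ (s≤s r<w) , w<s
        ... | inj₁ w<s         | inj₂ w<L = suc w , inUp w r<w w<L , <⇒≤ (s≤s r<w) , w<s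
        ... | inj₂ (inj₁ refl) | _        = suc r , sr , ≤-refl , r<s
        ... | inj₂ (inj₂ s<w)  | _        = ⊥-elim (n≮n _ (≤-trans s<w w≤s))

      -- Here the closed cycle is r, ..., 1, k, ..., s + 1; `s < k` supplies the edge 1 → k.
      noLoopDown : 1 ≤ r → s < k → R (suc s) r → ⊥
      noLoopDown 1≤r s<k sr = acyclic P range closed (inj₁ (1≤r , ≤-refl))
        where
        P : ℕ → Set
        P w = (1 ≤ w × w ≤ r) ⊎ (s < w × w ≤ k)
        range : ∀ {w} → P w → 1 ≤ w × w ≤ k
        range {w} (inj₁ (1≤w , w≤r)) =
          1≤w , ≤-trans (m≤n+m _ 3)
            (≤-trans (s≤s (s≤s (s≤s w≤r))) (≤-trans (s≤s (s≤s (s≤s r≤L))) 3+L≤k))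
        range {w} (inj₂ (s<w , w≤k)) = ≤-trans (s≤s z≤n) s<w , w≤k
        closed : ∀ w → P w → Σ[ x ∈ ℕ ] R w x × P x
        closed zero (inj₁ (() , _))
        closed zero (inj₂ (() , _))
        closed 1 (inj₁ _) = k , wrap s<k , inj₂ (s<k , ≤-refl)
        closed (suc (suc w)) (inj₁ (_ , w<r)) =
          suc w , inDown (suc w) (s≤s z≤n) w<r , inj₁ (s≤s z≤n , (<⇒≤ w<r))
        closed (suc w) (inj₂ (s<1+w , w<k)) with compare s w
        ... | inj₁ s<w         = w , outDown w s<w w<k , inj₂ (s<w , (<⇒≤ w<k))
        ... | inj₂ (inj₁ refl) = r , sr , inj₁ (1≤r , ≤-refl)
        ... | inj₂ (inj₂ w<s)  = ⊥-elim (n≮n _ (≤-trans s<1+w w<s))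

      -- Every other vertex above L has its successor in a run, and that successor lies above L,
      -- whereas a chord ends below L.
      chordSource : ∀ u {v} → R u v → Chord u v → (u ≡ s × L < s) ⊎ (u ≡ suc s × s < k)
      chordSource zero _ c with () ← proj₁ (chord-source c)
      chordSource (suc w) {v} wv c with chord-source c | chord-target c | compare (suc w) s |
          compare w s
      ... | L<w , w<k | _ , v<L | inj₁ w<s | _ =
          case fun wv (outUp (suc w) (<⇒≤ L<w) w<s) of λ e → ⊥-elim
            (n≮n _ (≤-trans (m≤n+m _ 2) (≤-trans (s≤s (s≤s L<w)) (≤-trans (s≤s (≥≡ e)) v<L))))
      chordSource (suc w) {v} wv c | L<w , w<k | _ , v<L | inj₂ (inj₁ e) | _ =
        inj₁ (e , (≤-trans L<w (≤≡ e)))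
      chordSource (suc w) {v} wv c | L<w , w<k | _ , v<L | inj₂ (inj₂ s<w) | inj₁ w<s =
        ⊥-elim (n≮n _ (≤-trans s<w w<s))
      chordSource (suc w) {v} wv c | L<w , w<k | _ , v<L | inj₂ (inj₂ s<w) | inj₂ (inj₁ e) =
        inj₂ (cong suc e , (≤-trans (s≤s (≥≡ e)) w<k))
      chordSource (suc w) {v} wv c | L<w , w<k | _ , v<L | inj₂ (inj₂ _) | inj₂ (inj₂ s<w) =
        case fun wv (outDown w s<w w<k) of λ e → ⊥-elim
            (n≮n _ (≤-trans L<w (≤-trans (s≤s (≥≡ e)) v<L)))

      chordTarget : ∀ {u} v → R u v → Chord u v → v ≡ r ⊎ v ≡ suc r
      chordTarget zero _ c with () ← proj₁ (chord-target c)
      chordTarget {u} (suc w) uw c with chord-source c | chord-target c | compare (suc w) r |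
          compare w r
      ... | L<u , _ | _ , w<L | inj₁ w<r | _ =
          case inj uw (inDown (suc w) (s≤s z≤n) w<r) of λ e → ⊥-elim
            (n≮n _ (≤-trans L<u (≤-trans (≤≡ e) w<L)))
      chordTarget {u} (suc w) uw c | L<u , _ | _ , w<L | inj₂ (inj₁ e) | _ = inj₁ e
      chordTarget {u} (suc w) uw c | L<u , _ | _ , w<L | inj₂ (inj₂ r<w) | inj₁ w<r =
        ⊥-elim (n≮n _ (≤-trans r<w w<r))
      chordTarget {u} (suc w) uw c | L<u , _ | _ , w<L | inj₂ (inj₂ r<w) | inj₂ (inj₁ e) =
        inj₂ (cong suc e)
      chordTarget {u} (suc w) uw c | L<u , _ | _ , w<L | inj₂ (inj₂ _) | inj₂ (inj₂ r<w) =
        case inj uw (inUp w r<w (<⇒≤ w<L)) of λ e → ⊥-elim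
            (n≮n _ (≤-trans (m≤n+m _ 2) (≤-trans (s≤s (s≤s L<u)) (≤-trans (s≤s (s≤s (≤≡ e))) w<L))))

      -- With chords and boundary edges excluded, both r and r + 1 would have to be entered from
      -- outside, but the heads 2l - 1 of incoming edges are all odd.
      noSplit : (∀ {u v} → R u v → Chord u v → ⊥) → (R k 1 → ⊥) → (R (suc L) L → ⊥) →
        1 ≤ r → r < L → ⊥
      noSplit noChord k1 top 1≤r r<L with downStart 1≤r | upStart r<L
      ... | _ , ur , inj₁ c | _ = noChord ur c
      ... | _ | _ , ur , inj₁ c = noChord ur c
      ... | _ , ur , inj₂ (inj₂ (inj₁ (e , e′))) | _ = k1 (subst₂ R e′ e ur)
      ... | _ , ur , inj₂ (inj₂ (inj₂ (e , e′))) | _ = top (subst₂ R e′ e ur)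
      ... | _ | _ , ur , inj₂ (inj₂ (inj₁ (e , e′))) = n≮0 (≤-trans 1≤r (≤≡ e))
      ... | _ | _ , ur , inj₂ (inj₂ (inj₂ (e , e′))) = top (subst₂ R e′ e ur)
      ... | _ , _ , inj₂ (inj₁ (_ , l , _ , _ , e , _)) | _ , _ , inj₂
            (inj₁ (_ , l′ , _ , _ , e′ , _)) =
        even≢odd l′ l (trans (sym e′) (cong suc e))

      leavesAt : ∀ {l u v} → R u v → k < v → T l u → v ≡ outHead l → Leaves l u
      leavesAt uv k<v t refl = k<v , t , uv

      entersAt : ∀ {l u v} → R u v → k < u → 1 ≤ l → l ≤ n → suc v ≡ 2 * l → u ≡ inTail l → Enters l
          v
      entersAt uv k<u 1≤l l≤n e refl = 1≤l , l≤n , e , k<u , uv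

      -- This finds the exit that accompanies chord B 0: vertex 1 cannot go to 2 by `leaveLow`, nor
      -- to k, which is already entered from k - 1.
      lowExit : s ≡ k → 1 ≤ r → Leaves 2 1
      lowExit s≡k 1≤r = split (next 1 ≤-refl 1≤k)
        where
        split : Next 1 → Leaves 2 1
        split (v , 1v , inj₁ (_ , _ , up refl))     = ⊥-elim (leaveLow 1≤r 1v)
        split (v , 1v , inj₁ (1≤v , _ , down e))    =
          ⊥-elim (n≮0 (≤-pred (≤-trans (s≤s 1≤v) (≥≡ e))))
        split (v , 1v , inj₁ (_ , _ , wrap₁ _ refl)) = ⊥-elim (noWrap s≡k 1v)
        split (v , 1v , inj₁ (_ , _ , wrap₂ e _))   =
          ⊥-elim (n≮0 (≤-trans (m≤n+m _ 8)
            (≤-pred (≤-trans (s≤s (s≤s (s≤s 7≤L))) (≤-trans 3+L≤k (≥≡ e))))))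
        split (v , 1v , inj₁ (_ , _ , chord c))     =
          case proj₁ (chord-source c) of λ L<1 → ⊥-elim
            (n≮0 (≤-trans (m≤n+m _ 6) (≤-pred (≤-trans (s≤s 7≤L) L<1))))
        split (v , 1v , inj₂ (k<v , l , t , ex , e)) with exit-label₂ ex
        ... | refl = leavesAt 1v k<v t e

      -- The counterpart for chord A 0: L cannot go to L - 1 by `leaveTop`, nor to L + 1, which is
      -- already entered from L + 2.
      topExit : s ≡ L → r < L → Σ[ l ∈ ℕ ] l + 1 + 0 ≡ n × Leaves l L
      topExit s≡L r<L = split (next L (≤-trans (m≤n+m _ 6) 7≤L) (≤-trans (m≤n+m _ 3) 3+L≤k))
        where
        split : Next L → Σ[ l ∈ ℕ ] l + 1 + 0 ≡ n × Leaves l L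
        split (v , Lv , inj₁ (_ , _ , up refl))   =
          case inj Lv (outDown (suc L) (s≤s (≤≡ s≡L)) (<⇒≤ 3+L≤k)) of λ ()
        split (v , Lv , inj₁ (_ , _ , down e))    = ⊥-elim (leaveTop v r<L (sym e) Lv)
        split (v , Lv , inj₁ (_ , _ , wrap₁ e _)) =
          ⊥-elim (n≮0 (≤-trans (m≤n+m _ 5) (≤-pred (≤-trans 7≤L (≤≡ e)))))
        split (v , Lv , inj₁ (_ , _ , wrap₂ e _)) =
          ⊥-elim (n≮n _ (≤-trans (m≤n+m _ 2) (≤-trans 3+L≤k (≥≡ e))))
        split (v , Lv , inj₁ (_ , _ , chord c))   = ⊥-elim (<-irrefl refl (proj₁ (chord-source c)))
        split (v , Lv , inj₂ (k<v , l , t , ex , e)) = l , exit-label-top ex , leavesAt Lv k<v t e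

      -- Ending at r + 1 is excluded by `noLoopUp`, so r = 2i + 2, and r + 1 can only be entered
      -- from outside, with label i + 2. The two conditions on t distinguish s = k, where i = 0 and
      -- the exit is at vertex 1, from s < k, where it is at s + 1.
      chordB : ∀ i {q t} → i ≤ b → s + 3 * i ≡ k → (∀ {u v} → R u v → Chord u v → u ≡ s) →
        R s q → Chord s q → q ≡ 2 * i + 2 → (s < k → t ≡ suc s) → (s ≡ k → t ≡ 1) →
        (1 ≤ r → Leaves (i + 2) t) → Passage
      chordB i {q} i≤b s≡ only sq c q≡ t< t≡ out with chordTarget q sq c | B-target q i i≤b q≡
      ... | inj₂ refl | 2≤q , q<L = ⊥-elim (noLoopUp (≤-trans (m≤n+m _ 5) (≤-trans q<L L≤s)) sq)
      ... | inj₁ refl | 2≤r , r<L = low (<⇒≤ 2≤r) (upStart (≤-trans (m≤n+m _ 4) r<L))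
        where
        low : 1 ≤ r → UpStart → Passage
        -- A chord into r + 1 would also start at s, which already goes to r.
        low 1≤r (u , ur , inj₁ c′) with only ur c′
        ... | refl = case fun sq ur of λ ()
        low 1≤r (u , ur , inj₂ (inj₂ (inj₁ (e , _)))) = ⊥-elim (n≮0 (<⇒≤ (≤-trans 2≤r (≤≡ e))))
        low 1≤r (u , ur , inj₂ (inj₂ (inj₂ (e , _)))) =
          ⊥-elim (n≮n _ (≤-trans (m≤n+m _ 3) (≤-trans (s≤s (s≤s (s≤s (s≤s (≥≡ e))))) r<L)))
        low 1≤r (u , ur , inj₂ (inj₁ (k<u , l , 1≤l , l≤n , e , u≡))) = record
          { l = l ; r = r ; h = suc r
          ; shape   = B i i≤b (sym l≡) q≡ s≡ refl refl t< t≡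
          ; follows = follow sq
          ; enters  = entersAt ur k<u 1≤l l≤n e u≡
          ; leaves  = subst (λ z → Leaves z _) l≡ (out 1≤r) }
          where
          l≡ : i + 2 ≡ l
          l≡ = B-label r i l q≡ e

      -- Mirror image of `chordB`: ending at r is excluded by `noLoopDown`, so the chord ends at r +
      -- 1, and r = L - 2 - 2i is entered from outside with label n - 1 - i.
      chordA : ∀ i {q} → i ≤ a → s ≡ L + 3 * i → s < k → (∀ {u v} → R u v → Chord u v → u ≡ suc s) →
        R (suc s) q → Chord (suc s) q → q + 1 + 2 * i ≡ L →
        (r < L → Σ[ l ∈ ℕ ] l + 1 + i ≡ n × Leaves l s) → Passage
      chordA i {q} i≤a s≡ s<k only sq c q≡ out with chordTarget q sq c | A-target q i i≤a q≡
      ... | inj₁ refl | 6≤r , r<L = ⊥-elim (noLoopDown (≤-trans (m≤n+m _ 5) 6≤r) s<k sq)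
      ... | inj₂ refl | 6≤q , q<L =
          high (out (<⇒≤ q<L)) (downStart (≤-trans (m≤n+m _ 4) (≤-pred 6≤q)))
        where
        high : (Σ[ l ∈ ℕ ] l + 1 + i ≡ n × Leaves l s) → DownStart → Passage
        high _ (u , ur , inj₁ c′) with only ur c′
        ... | refl = case fun sq ur of λ ()
        high _ (u , ur , inj₂ (inj₂ (inj₁ (e , _)))) =
          ⊥-elim (n≮0 (≤-trans (m≤n+m _ 3) (≤-pred (≤-pred (≤-trans 6≤q (s≤s (≤≡ e)))))))
        high _ (u , ur , inj₂ (inj₂ (inj₂ (e , _)))) =
          ⊥-elim (n≮n _ (<⇒≤ (≤-trans (s≤s (s≤s (≥≡ e))) q<L)))
        high (l , l≡ , lv) (u , ur , inj₂ (inj₁ (k<u , l′ , 1≤l , l≤n , e , u≡))) = record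
          { l = l ; r = r ; h = r
          ; shape   = A i i≤a l≡ q≡ s≡ refl refl refl
          ; follows = follow sq
          ; enters  = subst (λ z → Enters z r) l′≡l (entersAt ur k<u 1≤l l≤n e u≡)
          ; leaves  = lv }
          where
          l′≡l : l′ ≡ l
          l′≡l = +-cancelʳ-≡ 1 l′ l (+-cancelʳ-≡ i _ _ (trans (A-label (suc r) i l′ q≡ e) (sym l≡)))

      noBoth : ∀ {u v w} → R u v → v ≤ k → R u w → k < w → ⊥
      noBoth uv v≤k uw k<w = <⇒≱ k<w (subst (_≤ k) (fun uv uw) v≤k)

      chordsAtTop : s ≡ k → ∀ {u v} → R u v → Chord u v → u ≡ s
      chordsAtTop s≡k {u} uv c with chordSource u uv c
      ... | inj₁ (e , _)   = e
      ... | inj₂ (_ , s<k) = ⊥-elim (n≮n _ (≤-trans (s≤s (≥≡ s≡k)) s<k))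

      chordsAtBottom : s ≡ L → ∀ {u v} → R u v → Chord u v → u ≡ suc s
      chordsAtBottom s≡L {u} uv c with chordSource u uv c
      ... | inj₁ (_ , L<s) = ⊥-elim (n≮n _ (≤-trans L<s (≤≡ s≡L)))
      ... | inj₂ (e , _)   = e

      -- The only possible chord source k is taken by the exit, so `noSplit` leaves r = 0 or r = L.
      -- If r = L, then L would go both to L - 1 and to L + 1; so r = 0 and the entry is at vertex
      -- 1.
      splitFirst : s ≡ k → Leaves 1 k → Passage
      splitFirst s≡k lv@(k<v , _ , kv) with compare r L | ≤-<-connex 1 r
      ... | inj₂ (inj₂ L<r) | _ = ⊥-elim (n≮n _ (≤-trans L<r r≤L))
      ... | inj₂ (inj₁ e) | _ = ⊥-elim (descends (6 + 2 * (a + b)) L≡)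
        where
        descends : ∀ w → L ≡ suc w → ⊥
        descends w e′ =
          case fun (outUp L ≤-refl (≤-trans (m≤n+m _ 2) (≤-trans 3+L≤k (≥≡ s≡k))))
              (subst (λ z → R z w) (sym e′)
              (inDown w (≤-trans (m≤n+m _ 5) (≤-pred (≤-trans 7≤L (≤≡ e′))))
              (≤-trans (≥≡ e′) (≥≡ e))))
              of λ e″ → (⊥-elim (n≮n _ (<⇒≤ (≤-trans (s≤s (≤≡ e″)) (≥≡ e′)))))
      ... | inj₁ r<L | inj₁ 1≤r =
          ⊥-elim (noSplit noChord (λ k1 → noBoth k1 1≤k kv k<v) noTop 1≤r r<L)
        where
        noChord : ∀ {u v} → R u v → Chord u v → ⊥
        noChord {v = v} uv c with chord-target c
        ... | _ , v<L =
            noBoth (subst (λ z → R z v) (trans (chordsAtTop s≡k uv c) s≡k) uv)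
              (≤-trans (m≤n+m _ 4) (≤-trans (s≤s (s≤s (s≤s v<L))) 3+L≤k)) kv k<v
        noTop : R (suc L) L → ⊥
        noTop x =
          case fun x (outUp (suc L) (<⇒≤ (s≤s ≤-refl)) (<⇒≤ (≤-trans 3+L≤k (≥≡ s≡k)))) of λ ()
      ... | inj₁ r<L | inj₂ r<1 with upStart r<L
      ...   | u , ur , inj₁ c with chord-target c
      ...     | 2≤r , _ = ⊥-elim (n≮0 (≤-pred (≤-trans 2≤r r<1)))
      splitFirst s≡k lv@(k<v , _ , kv) | inj₁ r<L | inj₂ r<1
            | u , ur , inj₂ (inj₂ (inj₁ (e , e′))) =
        ⊥-elim (noBoth (subst₂ (λ x y → R x (suc y)) e′ e ur) 1≤k kv k<v)
      splitFirst s≡k lv | inj₁ r<L | inj₂ r<1 | u , ur , inj₂ (inj₂ (inj₂ (e , _))) =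
        ⊥-elim (n≮0 (≤-trans (m≤n+m _ 5) (≤-pred (≤-trans 7≤L (≤-trans (≥≡ e) r<1)))))
      splitFirst s≡k lv | inj₁ r<L | inj₂ r<1 | u , ur , inj₂ (inj₁ (k<u , l , 1≤l , l≤n , e , u≡))
          = record
        { l = 1 ; r = r ; h = suc r
        ; shape   = first refl r≡0 s≡k refl refl refl
        ; follows = follow (inUp 1 r<1 (≤-trans (m≤n+m _ 5) 7≤L))
        ; enters  = subst (λ z → Enters z (suc r)) l≡1 (entersAt ur k<u 1≤l l≤n e u≡)
        ; leaves  = lv }
        where
        r≡0 : r ≡ 0
        r≡0 = ≤-antisym (≤-pred r<1) z≤n
        l≡1 : l ≡ 1
        l≡1 = *-cancelˡ-≡ l 1 2 (trans (sym e) (cong (λ z → suc (suc z)) r≡0))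

      -- Dual to `splitFirst`: L + 1 is taken by its exit. If r = 0, then 1 would go both to 2 and
      -- to k; so r = L and the entry is at L = 2n - 1.
      splitLast : s ≡ L → Leaves n (suc L) → Passage
      splitLast s≡L lv@(k<v , _ , Lv) with compare r L | ≤-<-connex 1 r
      ... | inj₂ (inj₂ L<r) | _ = ⊥-elim (n≮n _ (≤-trans L<r r≤L))
      ... | inj₁ r<L | inj₂ r<1 =
          case fun (inUp 1 r<1 (≤-trans (m≤n+m _ 5) 7≤L))
            (wrap (≤-trans (m≤n+m _ 2) (≤-trans (s≤s (s≤s (s≤s (≤≡ s≡L)))) 3+L≤k))) of λ e → ⊥-elim
            (n≮0 (≤-trans (m≤n+m _ 7)
            (≤-pred (≤-pred (≤-trans (s≤s (s≤s (s≤s 7≤L))) (≤-trans 3+L≤k (≥≡ e)))))))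
      splitLast s≡L lv@(k<v , _ , Lv) | inj₁ r<L | inj₁ 1≤r =
        ⊥-elim (noSplit noChord (λ k1 → no2 k1
            (wrap (≤-trans (m≤n+m _ 2) (≤-trans (s≤s (s≤s (s≤s (≤≡ s≡L)))) 3+L≤k))) 1≤k ≤-refl
            (s≤s z≤n) 1≤k) (λ LL → noBoth LL (≤-trans (m≤n+m _ 3) 3+L≤k) Lv k<v) 1≤r r<L)
        where
        noChord : ∀ {u v} → R u v → Chord u v → ⊥
        noChord {v = v} uv c with chord-target c
        ... | _ , v<L =
          noBoth (subst (λ z → R z v) (trans (chordsAtBottom s≡L uv c) (cong suc s≡L)) uv)
              (≤-trans (m≤n+m _ 4) (≤-trans (s≤s (s≤s (s≤s v<L))) 3+L≤k)) Lv k<v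
      splitLast s≡L lv@(k<v , _ , Lv) | inj₂ (inj₁ r≡L) | inj₂ r<1 =
        ⊥-elim (n≮0 (≤-trans (m≤n+m _ 6) (≤-pred (≤-trans (s≤s 7≤L) (≤-trans (s≤s (≥≡ r≡L)) r<1)))))
      splitLast s≡L lv@(k<v , _ , Lv) | inj₂ (inj₁ r≡L) | inj₁ 1≤r with downStart 1≤r
      ... | u , ur , inj₁ c with chord-target c
      ...   | _ , r<L = ⊥-elim (n≮n _ (≤-trans (s≤s (≥≡ r≡L)) r<L))
      splitLast s≡L lv | inj₂ (inj₁ r≡L) | inj₁ 1≤r | u , ur , inj₂ (inj₂ (inj₁ (e , _))) =
        ⊥-elim (n≮0 (≤-trans (m≤n+m _ 5) (≤-pred (≤-trans 7≤L (≤-trans (≥≡ r≡L) (≤≡ e))))))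
      splitLast s≡L lv@(k<v , _ , Lv) | inj₂ (inj₁ r≡L) | inj₁ 1≤r | u , ur , inj₂
          (inj₂ (inj₂ (e , e′))) =
        ⊥-elim (noBoth (subst₂ R e′ e ur) (≤-trans (m≤n+m _ 3) 3+L≤k) Lv k<v)
      splitLast s≡L lv | inj₂ (inj₁ r≡L) | inj₁ 1≤r
            | u , ur , inj₂ (inj₁ (k<u , l , 1≤l , l≤n , e , u≡)) = record
        { l = n ; r = r ; h = r
        ; shape   = last refl r≡L s≡L refl refl refl
        ; follows = follow (wrap (≤-trans (m≤n+m _ 2) (≤-trans (s≤s (s≤s (s≤s (≤≡ s≡L)))) 3+L≤k)))
        ; enters  = subst (λ z → Enters z r) l≡n (entersAt ur k<u 1≤l l≤n e u≡)
        ; leaves  = lv }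
        where
        l≡n : l ≡ n
        l≡n = last-label l (trans (cong suc (sym r≡L)) e)

      -- For r = 0 the edge k → 1 closes the ascending runs; for r > 1 vertex 1 is already entered
      -- from 2. For r = 1 vertex 2 has no predecessor: it is even, and the only possible chord
      -- source k already goes to 1.
      notClosedTop : s ≡ k → R k 1 → ⊥
      notClosedTop s≡k k1 with compare r 1
      ... | inj₁ r<1 =
          noLoopUp (≤-trans (m≤n+m _ 6)
            (≤-trans (s≤s (s≤s (s≤s (s≤s (s≤s (s≤s r<1)))))) (≤-trans 7≤L L≤s)))
            (subst₂ R (sym s≡k) 1≡1+r k1)
        where
        1≡1+r : 1 ≡ suc r
        1≡1+r = ≤-antisym (s≤s z≤n) r<1
      ... | inj₂ (inj₂ 1<r) =
          case inj k1 (inDown 1 ≤-refl 1<r)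
            of λ e → (⊥-elim (n≮0 (≤-trans (m≤n+m _ 7)
            (≤-pred (≤-pred (≤-trans (s≤s (s≤s (s≤s 7≤L))) (≤-trans 3+L≤k (≤≡ e))))))))
      ... | inj₂ (inj₁ r≡1) =
          blocked (upStart (≤-trans (m≤n+m _ 5)
            (≤-trans (s≤s (s≤s (s≤s (s≤s (s≤s (s≤s (≤≡ r≡1))))))) 7≤L)))
        where
        blocked : UpStart → ⊥
        blocked (u , ur , inj₁ c) with fun k1
            (subst (λ z → R z (suc r)) (trans (chordsAtTop s≡k ur c) s≡k) ur)
        ... | e = n≮0 (≤-pred (≤-trans (s≤s (≥≡ r≡1)) (≥≡ e)))
        blocked (u , ur , inj₂ (inj₁ (_ , l , _ , _ , e , _))) =
          -- The constant 1 writes 3 = r + 2 as suc (2 * 1).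
          even≢odd l 1 (trans (sym e) (cong (λ z → suc (suc z)) r≡1))
        blocked (u , ur , inj₂ (inj₂ (inj₁ (e , _)))) = n≮0 (≤-trans (≥≡ r≡1) (≤≡ e))
        blocked (u , ur , inj₂ (inj₂ (inj₂ (e , _)))) =
          n≮0 (≤-trans (m≤n+m _ 4) (≤-pred (≤-pred (≤-trans 7≤L (≤-trans (≥≡ e) (s≤s (≤≡ r≡1)))))))

      -- The same three cases at the other end: the descending runs close, or L is entered twice, or
      -- the even vertex L - 1 has no predecessor.
      notClosedBottom : s ≡ L → R (suc L) L → ⊥
      notClosedBottom s≡L LL with compare r L | compare (suc r) L
      ... | inj₂ (inj₂ L<r) | _ = n≮n _ (≤-trans L<r r≤L)
      ... | inj₂ (inj₁ r≡L) | _ =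
          noLoopDown (≤-trans (m≤n+m _ 6) (≤-trans 7≤L (≥≡ r≡L)))
            (≤-trans (m≤n+m _ 2) (≤-trans (s≤s (s≤s (s≤s (≤≡ s≡L)))) 3+L≤k))
            (subst₂ R (cong suc (sym s≡L)) (sym r≡L) LL)
      ... | inj₁ r<L | inj₂ (inj₂ L<1+r) = n≮n _ (≤-trans L<1+r r<L)
      ... | inj₁ r<L | inj₁ 1+r<L = ascends (6 + 2 * (a + b)) L≡
        where
        ascends : ∀ w → L ≡ suc w → ⊥
        ascends w e =
          case inj LL (subst (R w) (sym e) (inUp w (≤-pred (≤-trans 1+r<L (≤≡ e))) (≥≡ e)))
            of λ e′ → (⊥-elim (n≮n _ (<⇒≤ (≤-trans (s≤s (≤≡ e′)) (≥≡ e)))))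
      ... | inj₁ r<L | inj₂ (inj₁ 1+r≡L) =
          penultimate (downStart (≤-trans (m≤n+m _ 5) (≤-pred (≤-trans 7≤L (≥≡ 1+r≡L)))))
        where
        penultimate : DownStart → ⊥
        penultimate (u , ur , inj₁ c)
          with fun LL (subst (λ z → R z r) (trans (chordsAtBottom s≡L ur c) (cong suc s≡L)) ur)
        ... | e = n≮n _ (≤-trans (s≤s (≤≡ e)) (≤≡ 1+r≡L))
        penultimate (u , ur , inj₂ (inj₁ (_ , l , _ , _ , e , _))) = even≢L l (trans (sym 1+r≡L) e)
        penultimate (u , ur , inj₂ (inj₂ (inj₁ (e , _)))) =
          n≮0 (≤-trans (m≤n+m _ 4) (≤-pred
            (≤-pred (≤-trans 7≤L (≤-trans (≥≡ 1+r≡L) (s≤s (≤≡ e)))))))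
        penultimate (u , ur , inj₂ (inj₂ (inj₂ (e , _)))) = n≮n _ (≤-trans (s≤s (≥≡ e)) (≤≡ 1+r≡L))

      -- Existence of a passage for each position of s

      passageTop : s ≡ k → Passage
      passageTop s≡k = finish (upEnd (≤-trans (m≤n+m _ 2) (≤-trans 3+L≤k (≥≡ s≡k))))
        where
        finish : UpEnd → Passage
        finish (v , sv , inj₂ (inj₁ (k<v , l , t , ex , e))) with exit-label₁
            (subst (Exit l) s≡k ex)
        ... | refl = splitFirst s≡k (subst (Leaves 1) s≡k (leavesAt sv k<v t e))
        finish (v , sv , inj₂ (inj₂ (_ , e))) = ⊥-elim (notClosedTop s≡k (subst₂ R s≡k e sv))
        finish (v , sv , inj₁ (A i i≤a u≡ v≡)) =
          ⊥-elim (n≮n _ (<⇒≤ (≤-trans (s≤s (s≤s (≥≡ s≡k)))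
            (≤-trans (s≤s (s≤s (A-chord-bound s i i≤a u≡))) 3+m≤k))))
        finish (v , sv , inj₁ c@(B i i≤b u≡ v≡)) =
          chordB i i≤b u≡ (chordsAtTop s≡k) sv c v≡
              (λ s<k → ⊥-elim (n≮n _ (≤-trans (s≤s (≥≡ s≡k)) s<k))) (λ _ → refl)
            (λ 1≤r → subst (λ z → Leaves z 1) 2≡i+2 (lowExit s≡k 1≤r))
          where
          2≡i+2 : 2 ≡ i + 2
          2≡i+2 = cong (_+ 2) (cancel₃ s 0 i (trans (+-identityʳ s) (trans s≡k (sym u≡))))

      passageBottom : s ≡ L → Passage
      passageBottom s≡L =
        finish (downEnd (≤-trans (m≤n+m _ 2) (≤-trans (s≤s (s≤s (s≤s (≤≡ s≡L)))) 3+L≤k)))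
        where
        finish : DownEnd → Passage
        finish (v , sv , inj₂ (inj₁ (k<v , l , t , ex , e))) with exit-label-n
            (subst (λ z → Exit l (suc z)) s≡L ex)
        ... | refl = splitLast s≡L (subst (λ z → Leaves n (suc z)) s≡L (leavesAt sv k<v t e))
        finish (v , sv , inj₂ (inj₂ (_ , e))) =
          ⊥-elim (notClosedBottom s≡L (subst₂ R (cong suc s≡L) e sv))
        finish (v , sv , inj₁ (B i i≤b u≡ v≡)) =
          ⊥-elim (n≮n _ (<⇒≤ (≤-pred
            (≤-trans (s≤s (s≤s (s≤s L≤m)))
            (≤-trans (proj₁ (B-bound 0 (suc s) i i≤b u≡)) (s≤s (≤≡ s≡L)))))))
        finish (v , sv , inj₁ c@(A i i≤a u≡ v≡)) =
          chordA i i≤a (suc-injective u≡)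
              (≤-trans (m≤n+m _ 2) (≤-trans (s≤s (s≤s (s≤s (≤≡ s≡L)))) 3+L≤k)) (chordsAtBottom s≡L)
              sv c v≡ out
          where
          0≡i : 0 ≡ i
          0≡i = cancel₃ L 0 i (trans (+-identityʳ L) (trans (sym s≡L) (suc-injective u≡)))
          out : r < L → Σ[ l ∈ ℕ ] l + 1 + i ≡ n × Leaves l s
          out r<L with topExit s≡L r<L
          ... | l , e , lv = l , subst (λ z → l + 1 + z ≡ n) 0≡i e , subst (Leaves l) (sym s≡L) lv

      -- Both outer runs are nonempty, so s and s + 1 each carry a chord or an exit. Two of a kind
      -- are never adjacent, and of the mixed pairs only a B-chord below its exit and an A-chord
      -- above its exit survive.
      passageBetween : L < s → s < k → Passage
      passageBetween L<s s<k with upEnd L<s | downEnd s<k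
      ... | _ , _ , inj₂ (inj₂ (s≡k , _)) | _ = ⊥-elim (n≮n _ (≤-trans (s≤s (≥≡ s≡k)) s<k))
      ... | _ | _ , _ , inj₂ (inj₂ (s≡L , _)) = ⊥-elim (n≮n _ (≤-trans L<s (≤≡ s≡L)))
      ... | _ , _ , inj₁ c | _ , _ , inj₁ c′ = ⊥-elim (chords-apart c c′)
      ... | _ , _ , inj₂ (inj₁ (_ , _ , _ , ex , _)) | _ , _ , inj₂ (inj₁ (_ , _ , _ , ex′ , _)) =
        ⊥-elim (exits-apart L<s s<k ex ex′)
      ... | v , sv , inj₁ c@(A i i≤a u≡ v≡) | w , sw , inj₂ (inj₁ (k<w , l , t , ex , e)) =
        ⊥-elim (chordA-below-exit i i≤a u≡ L<s s<k ex)
      ... | v , sv , inj₁ c@(B i i≤b u≡ v≡) | w , sw , inj₂ (inj₁ (k<w , l , t , ex , e)) =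
        chordB i i≤b u≡ only sv c v≡ (λ _ → refl)
            (λ s≡k → ⊥-elim (n≮n _ (≤-trans (s≤s (≥≡ s≡k)) s<k)))
          (λ _ → subst (λ z → Leaves z (suc s)) (chordB-below-exit i i≤b u≡ L<s s<k ex)
              (leavesAt sw k<w t e))
        where
        only : ∀ {u v} → R u v → Chord u v → u ≡ s
        only {u} {v} uv c′ with chordSource u uv c′ | chord-target c′
        ... | inj₁ (e′ , _) | _       = e′
        ... | inj₂ (e′ , _) | _ , v<L =
            ⊥-elim (noBoth (subst (λ z → R z v) e′ uv)
              (≤-trans (m≤n+m _ 4) (≤-trans (s≤s (s≤s (s≤s v<L))) 3+L≤k)) sw k<w)
      ... | v , sv , inj₂ (inj₁ (k<v , l , t , ex , e)) | w , sw , inj₁ c@(B i i≤b u≡ v≡) =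
        ⊥-elim (exit-below-chordB i i≤b u≡ L<s s<k ex)
      ... | v , sv , inj₂ (inj₁ (k<v , l , t , ex , e)) | w , sw , inj₁ c@(A i i≤a u≡ v≡) =
        chordA i i≤a (suc-injective u≡) s<k only sw c v≡
          (λ _ → l , exit-below-chordA i i≤a u≡ L<s s<k ex , leavesAt sv k<v t e)
        where
        only : ∀ {u v} → R u v → Chord u v → u ≡ suc s
        only {u} {v} uv c′ with chordSource u uv c′ | chord-target c′
        ... | inj₂ (e′ , _) | _       = e′
        ... | inj₁ (e′ , _) | _ , v<L =
            ⊥-elim (noBoth (subst (λ z → R z v) e′ uv)
              (≤-trans (m≤n+m _ 4) (≤-trans (s≤s (s≤s (s≤s v<L))) 3+L≤k)) sv k<v)

      passage : Passage
      passage with compare s k | compare L s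
      ... | inj₂ (inj₁ s≡k) | _               = passageTop s≡k
      ... | inj₁ _          | inj₂ (inj₁ L≡s) = passageBottom (sym L≡s)
      ... | inj₁ s<k        | inj₁ L<s        = passageBetween L<s s<k
      ... | inj₂ (inj₂ k<s) | _               = ⊥-elim (<⇒≱ k<s s≤k)
      ... | _               | inj₂ (inj₂ s<L) = ⊥-elim (<⇒≱ s<L L≤s)

    abstract
      aPassage : Passage
      aPassage = let _ , _ , run = runs in Analysis.passage run

    -- Uniqueness of the entry, the exit and the path

    module _ (π : Passage) where
      open Passage π

      -- Every crown vertex except h has a predecessor on the path inside the crown, and
      -- predecessors in a cycle are unique.
      entry-unique : ∀ {u v} → k < u → 1 ≤ v → v ≤ k → R u v → v ≡ h × u ≡ inTail l
      entry-unique {u} {v} k<u 1≤v v≤k uv with target-cover v shape (proj₁ (proj₂ (proj₂ enters)))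
          1≤v v≤k
      ... | inj₁ (w , _ , w≤k , path) = ⊥-elim (<⇒≱ k<u (subst (_≤ k) (inj (follows path) uv) w≤k))
      ... | inj₂ refl = refl , inj uv (proj₂ (proj₂ (proj₂ (proj₂ enters))))

      exit-unique : ∀ {u v} → 1 ≤ u → u ≤ k → k < v → R u v → u ≡ t × v ≡ outHead l
      exit-unique {u} {v} 1≤u u≤k k<v uv with source-cover u shape 1≤u u≤k
      ... | inj₁ (w , _ , w≤k , path) = ⊥-elim (<⇒≱ k<v (subst (_≤ k) (fun (follows path) uv) w≤k))
      ... | inj₂ refl = refl , fun uv (proj₂ (proj₂ leaves))

      on-path : ∀ {u v} → 1 ≤ u → u ≤ k → v ≤ k → R u v → Path r s p q u v
      on-path {u} {v} 1≤u u≤k v≤k uv with source-cover u shape 1≤u u≤k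
      ... | inj₁ (w , _ , _ , path) with fun uv (follows path)
      ...   | refl = path
      on-path {u} {v} 1≤u u≤k v≤k uv | inj₂ refl with fun uv (proj₂ (proj₂ leaves))
      ...   | refl = ⊥-elim (<⇒≱ (proj₁ leaves) v≤k)

  same-path : ∀ {l l′ r s p q t r′ s′ p′ q′ t′ u v} → l ≡ l′ →
    Shape l r s p q t → Shape l′ r′ s′ p′ q′ t′ → Path r s p q u v → Path r′ s′ p′ q′ u v
  same-path refl sh sh′ path with shape-unique sh sh′
  ... | refl , refl , refl , refl = path

  same-route : ∀ (C D : Cycle) (π : Trace.Passage C) (ρ : Trace.Passage D) →
    Trace.Passage.l π ≡ Trace.Passage.l ρ →
    ∀ {u v} → 1 ≤ u → u ≤ k → v ≤ k → Cycle.R C u v → Cycle.R D u v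
  same-route C D π ρ e 1≤u u≤k v≤k uv = Trace.Passage.follows ρ
    (same-path e (Trace.Passage.shape π) (Trace.Passage.shape ρ) (Trace.on-path C π 1≤u u≤k v≤k uv))

-- Application to Hamiltonian cycles of the graph

module Graph (a b n N : ℕ) (a≡ : ⌈ (n ∸ 4) /2⌉ ≡ a) (b≡ : ⌊ (n ∸ 4) /2⌋ ≡ b) (n≡ : n ≡ 4 + (a + b))
  (K<N : K n < N) (E : ℕ → ℕ → Set)
  (crown : ∀ u v → InCrown n u → InCrown n v → (E u v ⇔ CrownEdge n u v))
  (inTail : ℕ → ℕ)
  (ins : ∀ u v → Outside N n u → InCrown n v → E u v →
    Σ ℕ (λ l → (1 ≤ l × l ≤ n) × (u ≡ inTail l × v ≡ 2 * l ∸ 1)))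
  (outHead : ℕ → ℕ)
  (outs : ∀ u v → InCrown n u → Outside N n v → E u v → Σ ℕ (λ l → OutTail n l u × v ≡ outHead l))
  where

  L m k : ℕ
  L = 7 + 2 * (a + b)
  m = L + 3 * a
  k = 3 + m + 3 * b

  sizes : Dimensions a b L m k n
  sizes = record { L≡ = refl ; m≡ = refl ; k≡ = refl ; n≡ = n≡ }

  open Crown a b L m k n sizes

  ≤K : ∀ {v} → v ≤ k → v ≤ K n
  ≤K {v} = subst (v ≤_) (sym K≡k)

  ≤k : ∀ {v} → v ≤ K n → v ≤ k
  ≤k {v} = subst (v ≤_) K≡k

  k<_ : ∀ {v} → K n < v → k < v
  k<_ {v} = subst (_< v) K≡k

  K<_ : ∀ {v} → k < v → K n < v
  K<_ {v} = subst (_< v) (sym K≡k)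

  head≡ : ∀ {l v} → 1 ≤ l → v ≡ 2 * l ∸ 1 → suc v ≡ 2 * l
  head≡ {l} 1≤l e = trans (cong suc e) (m+[n∸m]≡n (≤-trans 1≤l (m≤m+n l _)))

  cycle : ∀ vs → HamCycle N E vs → Cycle
  cycle vs (unique , mem , edges) = record
    { R       = CycEdge vs
    ; inTail  = inTail
    ; outHead = outHead
    ; T       = OutTail n
    ; fun     = cycle-functional vs unique
    ; inj     = cycle-injective vs unique
    ; next    = next
    ; prev    = prev
    ; acyclic = acyclic }
    where
    vertex : ∀ {v} → 1 ≤ v → v ≤ k → v ∈ vs
    vertex 1≤v v≤k = Equivalence.from (mem _) (1≤v , ≤-trans (≤K v≤k) (<⇒≤ K<N))
    next : ∀ u → 1 ≤ u → u ≤ k → Σ[ v ∈ ℕ ] CycEdge vs u v × ((1 ≤ v × v ≤ k × Step u v) ⊎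
      (k < v × Σ[ l ∈ ℕ ] OutTail n l u × Exit l u × v ≡ outHead l))
    next u 1≤u u≤k with cycle-next vs (vertex 1≤u u≤k)
    ... | v , uv with Equivalence.to (mem v) (cycle-target vs uv) | ≤-<-connex v k
    ...   | 1≤v , v≤N | inj₁ v≤k =
        v , uv , inj₁ (1≤v , v≤k , crown-step (≤-reflexive a≡) (≤-reflexive b≡)
      (Equivalence.to (crown u v (1≤u , ≤K u≤k) (1≤v , ≤K v≤k)) (edges u v uv)))
    ...   | 1≤v , v≤N | inj₂ k<v with outs u v (1≤u , ≤K u≤k) (K< k<v , v≤N) (edges u v uv)
    ...     | l , tail , e =
      v , uv , inj₂ (k<v , l , tail , crown-exit (≤-reflexive a≡) (≤-reflexive b≡) tail , e)
    prev : ∀ v → 1 ≤ v → v ≤ k → Σ[ u ∈ ℕ ] CycEdge vs u v × ((1 ≤ u × u ≤ k × Step u v) ⊎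
      (k < u × Σ[ l ∈ ℕ ] 1 ≤ l × l ≤ n × suc v ≡ 2 * l × u ≡ inTail l))
    prev v 1≤v v≤k with cycle-prev vs (vertex 1≤v v≤k)
    ... | u , uv with Equivalence.to (mem u) (cycle-source vs uv) | ≤-<-connex u k
    ...   | 1≤u , u≤N | inj₁ u≤k =
        u , uv , inj₁ (1≤u , u≤k , crown-step (≤-reflexive a≡) (≤-reflexive b≡)
      (Equivalence.to (crown u v (1≤u , ≤K u≤k) (1≤v , ≤K v≤k)) (edges u v uv)))
    ...   | 1≤u , u≤N | inj₂ k<u with ins u v (K< k<u , u≤N) (1≤v , ≤K v≤k) (edges u v uv)
    ...     | l , (1≤l , l≤n) , u≡ , v≡ = u , uv , inj₂ (k<u , l , 1≤l , l≤n , head≡ 1≤l v≡ , u≡)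
    -- A closed `P` spreads along the whole cycle and reaches vertex N, which lies outside the crown
    -- because `K n < N`.
    acyclic : ∀ (P : ℕ → Set) → (∀ {u} → P u → 1 ≤ u × u ≤ k) →
      (∀ u → P u → Σ[ v ∈ ℕ ] CycEdge vs u v × P v) → ∀ {u} → P u → ⊥
    acyclic P range closed {u} pu = <⇒≱ (k< K<N) (proj₂ (range
      (cycle-sweep P vs step (vertex (proj₁ (range pu)) (proj₂ (range pu))) pu N∈)))
      where
      N∈ : N ∈ vs
      N∈ = Equivalence.from (mem N) (≤-trans (s≤s z≤n) K<N , ≤-refl)
      step : ∀ {x y} → CycEdge vs x y → P x → P y
      step {x} xy px with closed x px
      ... | y , xy′ , py = subst P (cycle-functional vs unique xy′ xy) py

  route : ∀ vs (ham : HamCycle N E vs) → Trace.Passage (cycle vs ham)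
  route vs ham = Trace.aPassage (cycle vs ham)

  one-entry-one-exit : ∀ vs → HamCycle N E vs →
    Σ ℕ (λ l → (1 ≤ l × l ≤ n)
      × (CycEdge vs (inTail l) (2 * l ∸ 1)
         × (∀ u v → Outside N n u → InCrown n v → CycEdge vs u v → u ≡ inTail l × v ≡ 2 * l ∸ 1))
      × Σ ℕ (λ t → OutTail n l t × CycEdge vs t (outHead l)
         × (∀ u v → InCrown n u → Outside N n v → CycEdge vs u v → u ≡ t × v ≡ outHead l)))
  one-entry-one-exit vs ham = summary (route vs ham)
    where
    summary : (π : Trace.Passage (cycle vs ham)) → _
    summary π = l , (1≤l , l≤n) , (subst (CycEdge vs _) h≡2l∸1 xh , into) , t , tail , ty , out
      where
      open Trace.Passage π
      1≤l : 1 ≤ l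
      1≤l = proj₁ enters
      l≤n : l ≤ n
      l≤n = proj₁ (proj₂ enters)
      xh : CycEdge vs (inTail l) h
      xh = proj₂ (proj₂ (proj₂ (proj₂ enters)))
      tail : OutTail n l t
      tail = proj₁ (proj₂ leaves)
      ty : CycEdge vs t (outHead l)
      ty = proj₂ (proj₂ leaves)
      h≡2l∸1 : h ≡ 2 * l ∸ 1
      h≡2l∸1 = cong (_∸ 1) (proj₁ (proj₂ (proj₂ enters)))
      into : ∀ u v → Outside N n u → InCrown n v → CycEdge vs u v → u ≡ inTail l × v ≡ 2 * l ∸ 1
      into u v (K<u , _) (1≤v , v≤K) uv =
        let v≡h , u≡ = Trace.entry-unique (cycle vs ham) π (k< K<u) 1≤v (≤k v≤K) uv
        in u≡ , trans v≡h h≡2l∸1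
      out : ∀ u v → InCrown n u → Outside N n v → CycEdge vs u v → u ≡ t × v ≡ outHead l
      out u v (1≤u , u≤K) (K<v , _) = Trace.exit-unique (cycle vs ham) π 1≤u (≤k u≤K) (k< K<v)

  -- The passage knows its only entering edge, so comparing the heads 2l - 1 recovers the label.
  label-of : ∀ {l} vs (ham : HamCycle N E vs) → 1 ≤ l → l ≤ n → Outside N n (inTail l) →
    CycEdge vs (inTail l) (2 * l ∸ 1) → l ≡ Trace.Passage.l (route vs ham)
  label-of {l} vs ham 1≤l l≤n (K<x , _) xv =
    *-cancelˡ-≡ _ _ 2 (trans (sym (head≡ 1≤l refl)) (trans (cong suc v≡h) h≡))
    where
    π : Trace.Passage (cycle vs ham)
    π = route vs ham
    h≡ : suc (Trace.Passage.h π) ≡ 2 * Trace.Passage.l π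
    h≡ = proj₁ (proj₂ (proj₂ (Trace.Passage.enters π)))
    1≤v : 1 ≤ 2 * l ∸ 1
    1≤v = m+n≤o⇒m≤o∸n 1 (*-monoʳ-≤ 2 1≤l)
    v≤k : 2 * l ∸ 1 ≤ k
    v≤k = ≤-trans (head≤L _ l (head≡ 1≤l refl) l≤n) (≤-trans L≤m (≤-trans (m≤n+m _ 3) 3+m≤k))
    v≡h : 2 * l ∸ 1 ≡ Trace.Passage.h π
    v≡h = proj₁ (Trace.entry-unique (cycle vs ham) π (k< K<x) 1≤v v≤k xv)

  same-edges : ∀ {l} vs ws → HamCycle N E vs → HamCycle N E ws → 1 ≤ l → l ≤ n → Outside N n
      (inTail l) →
    CycEdge vs (inTail l) (2 * l ∸ 1) → CycEdge ws (inTail l) (2 * l ∸ 1) →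
    ∀ {u v} → InCrown n u → InCrown n v → CycEdge vs u v → CycEdge ws u v
  same-edges vs ws ham ham′ 1≤l l≤n out xv xw (1≤u , u≤K) (_ , v≤K) =
    same-route (cycle vs ham) (cycle ws ham′) (route vs ham) (route ws ham′)
      (trans (sym (label-of vs ham 1≤l l≤n out xv)) (label-of ws ham′ 1≤l l≤n out xw))
      1≤u (≤k u≤K) (≤k v≤K)

theorem1 : (n : ℕ) → 4 ≤ n →
  (N : ℕ) → K n < N →
  (E : ℕ → ℕ → Set) →
  (∀ u v → InCrown n u → InCrown n v → (E u v ⇔ CrownEdge n u v)) →
  (inTail : ℕ → ℕ) →
  (∀ l → 1 ≤ l → l ≤ n → Outside N n (inTail l) × E (inTail l) (2 * l ∸ 1)) →
  (∀ u v → Outside N n u → InCrown n v → E u v →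
    Σ ℕ (λ l → (1 ≤ l × l ≤ n) × (u ≡ inTail l × v ≡ 2 * l ∸ 1))) →
  (outHead : ℕ → ℕ) →
  (∀ l t → OutTail n l t → Outside N n (outHead l) × E t (outHead l)) →
  (∀ u v → InCrown n u → Outside N n v → E u v →
    Σ ℕ (λ l → OutTail n l u × v ≡ outHead l)) →
  (∀ vs → HamCycle N E vs →
    Σ ℕ (λ l → (1 ≤ l × l ≤ n)
      × (CycEdge vs (inTail l) (2 * l ∸ 1)
         × (∀ u v → Outside N n u → InCrown n v → CycEdge vs u v →
              u ≡ inTail l × v ≡ 2 * l ∸ 1))
      × Σ ℕ (λ t → OutTail n l t × CycEdge vs t (outHead l)
         × (∀ u v → InCrown n u → Outside N n v → CycEdge vs u v →
              u ≡ t × v ≡ outHead l))))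
  × (∀ l → 1 ≤ l → l ≤ n → ∀ vs ws → HamCycle N E vs → HamCycle N E ws →
      CycEdge vs (inTail l) (2 * l ∸ 1) → CycEdge ws (inTail l) (2 * l ∸ 1) →
      ∀ u v → InCrown n u → InCrown n v → (CycEdge vs u v ⇔ CycEdge ws u v))
theorem1 n 4≤n N K<N E crown inTail in∃ in! outHead out∃ out! =
  one-entry-one-exit ,
  λ l 1≤l l≤n vs ws ham ham′ xv xw u v u∈ v∈ →
    let x-out = proj₁ (in∃ l 1≤l l≤n) in
    mk⇔ (same-edges vs ws ham ham′ 1≤l l≤n x-out xv xw u∈ v∈)
        (same-edges ws vs ham′ ham 1≤l l≤n x-out xw xv u∈ v∈)
  where
  n≡ : n ≡ 4 + (⌈ (n ∸ 4) /2⌉ + ⌊ (n ∸ 4) /2⌋)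
  n≡ = sym (trans (cong (4 +_) (trans (+-comm ⌈ (n ∸ 4) /2⌉ _) (⌊n/2⌋+⌈n/2⌉≡n (n ∸ 4))))
      (m+[n∸m]≡n 4≤n))
  open Graph _ _ n N refl refl n≡ K<N E crown inTail in! outHead out!
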